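{- Let $n\geq 3$ and let $D$ be a simple strongly connected digraph on $n$ vertices which is not isomorphic to the complete digraph $\overset{\longleftrightarrow}{K_n}$ and not isomorphic to $\overrightarrow{K}(n,n-2,1)$. Then $$q(D)<\frac{3n-5+\sqrt{n^2+2n-7}}{2}.$$
   Context: Digraphs are finite and simple (no loops, no multiple arcs; opposite arcs allowed). $q(D)$ is the spectral radius of the signless Laplacian matrix $Q(D)=\mathrm{diag}(d_1^+,\ldots,d_n^+)+A(D)$, where $d_i^+$ is the outdegree of vertex $i$ and $A(D)$ is the adjacency matrix. $\overset{\longleftrightarrow}{K_n}$ is the digraph on $n$ vertices with all arcs $(i,j)$, $i\neq j$. $\overrightarrow{K}(n,n-2,1)$ is the digraph obtained from $\overset{\longleftrightarrow}{K_n}$ by deleting a single arc. -}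

module Defs where

open import Algebra.Bundles.Raw using (RawMonoid)
import Algebra.Definitions.RawMonoid as Sum
open import Data.Bool using (Bool; true; false; not; _∧_; if_then_else_; T)
open import Data.Fin using (Fin)
import Data.Fin.Properties as Fin
open import Data.Fin.Permutation using (Permutation′; _⟨$⟩ʳ_)
open import Data.Integer using (+_)
import Data.Integer as ℤ
import Data.Integer.Properties as ℤ
open import Data.Nat using (ℕ; zero; suc)
import Data.Nat as ℕ
import Data.Nat.DivMod as ℕ
import Data.Nat.Properties as ℕ
import Data.Nat.Tactic.RingSolver as ℕ-Ring
open import Data.Product using (Σ; ∃; ∃₂; _×_; _,_; proj₁; proj₂)
open import Data.Rational using (ℚ; 0ℚ; 1ℚ; ½; ↥_; ↧ₙ_)
import Data.Rational as ℚ
import Data.Rational.Properties as ℚ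
open import Data.Rational.Solver using (module +-*-Solver)
import Data.Rational.Unnormalised as ℚᵘ
import Data.Rational.Unnormalised.Properties as ℚᵘ
open import Data.Sum using (inj₁; inj₂)
open import Data.Vec.Functional using (Vector)
open import Level using (0ℓ)
open import Relation.Binary.Construct.Closure.ReflexiveTransitive using (Star)
open import Relation.Binary.PropositionalEquality
  using (_≡_; _≢_; refl; sym; trans; cong; cong₂; subst; subst₂)
open import Relation.Nullary using (¬_; does; yes; no; contradiction)

open +-*-Solver using (solve; _:+_; _:*_; _:-_; :-_; _:=_; con)

p≤∣p∣ : ∀ p → p ℚ.≤ ℚ.∣ p ∣
p≤∣p∣ p with ℚ.∣p∣≡p∨∣p∣≡-p p | ℚ.≤-total 0ℚ p
... | inj₁ e | _        = ℚ.≤-reflexive (sym e)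
... | inj₂ _ | inj₁ 0≤p = ℚ.≤-reflexive (sym (ℚ.0≤p⇒∣p∣≡p 0≤p))
... | inj₂ _ | inj₂ p≤0 = ℚ.≤-trans p≤0 (ℚ.0≤∣p∣ p)

-p≤∣p∣ : ∀ p → ℚ.- p ℚ.≤ ℚ.∣ p ∣
-p≤∣p∣ p = subst (ℚ.- p ℚ.≤_) (ℚ.∣-p∣≡∣p∣ p) (p≤∣p∣ (ℚ.- p))

∣p-q∣≡∣q-p∣ : ∀ p q → ℚ.∣ p ℚ.- q ∣ ≡ ℚ.∣ q ℚ.- p ∣
∣p-q∣≡∣q-p∣ p q = trans (sym (ℚ.∣-p∣≡∣p∣ (p ℚ.- q)))
  (cong ℚ.∣_∣ (solve 2 (λ p q → :- (p :- q) := q :- p) refl p q))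

∣p-q∣<r⇒p<q+r : ∀ p q r → ℚ.∣ p ℚ.- q ∣ ℚ.< r → p ℚ.< q ℚ.+ r
∣p-q∣<r⇒p<q+r p q r h = subst (ℚ._< q ℚ.+ r)
  (solve 2 (λ p q → q :+ (p :- q) := p) refl p q)
  (ℚ.+-monoʳ-< q (ℚ.≤-<-trans (p≤∣p∣ (p ℚ.- q)) h))

p<q+r⇒∣p-q∣<r : ∀ p q r → p ℚ.< q ℚ.+ r → q ℚ.< p ℚ.+ r → ℚ.∣ p ℚ.- q ∣ ℚ.< r
p<q+r⇒∣p-q∣<r p q r h₁ h₂ with ℚ.∣p∣≡p∨∣p∣≡-p (p ℚ.- q)
... | inj₁ e = subst₂ ℚ._<_ (sym e)
  (solve 2 (λ q r → q :+ r :- q := r) refl q r) (ℚ.+-monoˡ-< (ℚ.- q) h₁)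
... | inj₂ e = subst₂ ℚ._<_
  (trans (solve 2 (λ p q → q :- p := :- (p :- q)) refl p q) (sym e))
  (solve 2 (λ p r → p :+ r :- p := r) refl p r) (ℚ.+-monoˡ-< (ℚ.- p) h₂)

0<p*q : ∀ {p q} → 0ℚ ℚ.< p → 0ℚ ℚ.< q → 0ℚ ℚ.< p ℚ.* q
0<p*q {p} {q} 0<p 0<q =
  ℚ.positive⁻¹ (p ℚ.* q) {{ℚ.pos*pos⇒pos p {{ℚ.positive 0<p}} q {{ℚ.positive 0<q}}}}

0<½p : ∀ {p} → 0ℚ ℚ.< p → 0ℚ ℚ.< ½ ℚ.* p
0<½p = 0<p*q (ℚ.positive⁻¹ ½)

*-mono-≤ : ∀ {p q r s} → 0ℚ ℚ.≤ p → 0ℚ ℚ.≤ s → p ℚ.≤ q → r ℚ.≤ s →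
           p ℚ.* r ℚ.≤ q ℚ.* s
*-mono-≤ {p} {q} {r} {s} 0≤p 0≤s p≤q r≤s = ℚ.≤-trans
  (ℚ.*-monoˡ-≤-nonNeg p {{ℚ.nonNegative 0≤p}} r≤s)
  (ℚ.*-monoʳ-≤-nonNeg s {{ℚ.nonNegative 0≤s}} p≤q)

square-cancel-< : ∀ {p q} → 0ℚ ℚ.≤ q → p ℚ.* p ℚ.< q ℚ.* q → p ℚ.< q
square-cancel-< {p} {q} 0≤q h = ℚ.≰⇒> λ q≤p →
  ℚ.<-irrefl refl (ℚ.<-≤-trans h (*-mono-≤ 0≤q (ℚ.≤-trans 0≤q q≤p) q≤p q≤p))

divide : ∀ p q → 0ℚ ℚ.< p → 0ℚ ℚ.< q → ∃ λ r → 0ℚ ℚ.< r × q ℚ.* r ≡ p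
divide p q 0<p 0<q = 1/q ℚ.* p , 0<p*q 0<1/q 0<p ,
  trans (sym (ℚ.*-assoc q 1/q p))
    (trans (cong (ℚ._* p) (ℚ.*-inverseʳ q {{q≠0}})) (ℚ.*-identityˡ p))
  where
  q≠0   = ℚ.pos⇒nonZero q {{ℚ.positive 0<q}}
  1/q   = (ℚ.1/ q) {{q≠0}}
  0<1/q = ℚ.positive⁻¹ 1/q {{ℚ.1/pos⇒pos q {{ℚ.positive 0<q}}}}

split : ∀ ε p q → 0ℚ ℚ.< ε → 0ℚ ℚ.< p → 0ℚ ℚ.< q →
  ∃ λ δ → 0ℚ ℚ.< δ × p ℚ.* δ ℚ.+ δ ℚ.* q ≡ ε
split ε p q 0<ε 0<p 0<q =
  let δ , 0<δ , eq = divide ε (p ℚ.+ q) 0<ε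
        (subst (ℚ._< p ℚ.+ q) (ℚ.+-identityʳ 0ℚ) (ℚ.+-mono-< 0<p 0<q))
  in δ , 0<δ , trans (solve 3 (λ d p q → p :* d :+ d :* q := (p :+ q) :* d) refl δ p q) eq

∣pr-qs∣< : ∀ p q r s {A B δ} → 0ℚ ℚ.< A → 0ℚ ℚ.< B → ℚ.∣ p ∣ ℚ.≤ A → ℚ.∣ s ∣ ℚ.≤ B →
  ℚ.∣ p ℚ.- q ∣ ℚ.< δ → ℚ.∣ r ℚ.- s ∣ ℚ.< δ →
  ℚ.∣ p ℚ.* r ℚ.- q ℚ.* s ∣ ℚ.< A ℚ.* δ ℚ.+ δ ℚ.* B
∣pr-qs∣< p q r s {A} {B} {δ} 0<A 0<B p≤A s≤B pq rs = begin-strict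
  ℚ.∣ p ℚ.* r ℚ.- q ℚ.* s ∣
    ≡⟨ cong ℚ.∣_∣ (solve 4 (λ p q r s → p :* r :- q :* s := p :* (r :- s) :+ (p :- q) :* s)
         refl p q r s) ⟩
  ℚ.∣ p ℚ.* (r ℚ.- s) ℚ.+ (p ℚ.- q) ℚ.* s ∣
    ≤⟨ ℚ.∣p+q∣≤∣p∣+∣q∣ (p ℚ.* (r ℚ.- s)) ((p ℚ.- q) ℚ.* s) ⟩
  ℚ.∣ p ℚ.* (r ℚ.- s) ∣ ℚ.+ ℚ.∣ (p ℚ.- q) ℚ.* s ∣
    ≡⟨ cong₂ ℚ._+_ (ℚ.∣p*q∣≡∣p∣*∣q∣ p (r ℚ.- s)) (ℚ.∣p*q∣≡∣p∣*∣q∣ (p ℚ.- q) s) ⟩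
  ℚ.∣ p ∣ ℚ.* ℚ.∣ r ℚ.- s ∣ ℚ.+ ℚ.∣ p ℚ.- q ∣ ℚ.* ℚ.∣ s ∣
    ≤⟨ ℚ.+-mono-≤
         (*-mono-≤ (ℚ.0≤∣p∣ p) (ℚ.0≤∣p∣ (r ℚ.- s)) p≤A ℚ.≤-refl)
         (*-mono-≤ (ℚ.0≤∣p∣ (p ℚ.- q)) (ℚ.<⇒≤ 0<B) ℚ.≤-refl s≤B) ⟩
  A ℚ.* ℚ.∣ r ℚ.- s ∣ ℚ.+ ℚ.∣ p ℚ.- q ∣ ℚ.* B
    <⟨ ℚ.+-mono-< (ℚ.*-monoʳ-<-pos A {{ℚ.positive 0<A}} rs)
                  (ℚ.*-monoˡ-<-pos B {{ℚ.positive 0<B}} pq) ⟩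
  A ℚ.* δ ℚ.+ δ ℚ.* B ∎
  where open ℚ.≤-Reasoning

-- Reals are Cauchy sequences of rationals. Distinct sequences may represent the
-- same number: equality of reals is _≈_, not _≡_.
IsCauchy : (ℕ → ℚ) → Set
IsCauchy x = ∀ ε → 0ℚ ℚ.< ε →
  ∃ λ N → ∀ m n → N ℕ.≤ m → N ℕ.≤ n → ℚ.∣ x m ℚ.- x n ∣ ℚ.< ε

record ℝ : Set where
  constructor mkℝ
  field
    seq      : ℕ → ℚ
    isCauchy : IsCauchy seq

open ℝ public

infix 4 _≈_ _<_ _≤_

_≈_ : ℝ → ℝ → Set
x ≈ y = ∀ ε → 0ℚ ℚ.< ε →
  ∃ λ N → ∀ n → N ℕ.≤ n → ℚ.∣ seq x n ℚ.- seq y n ∣ ℚ.< ε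

-- x n < y n + ε eventually, for every ε: no inequality between individual terms
-- is implied
_≤_ : ℝ → ℝ → Set
x ≤ y = ∀ ε → 0ℚ ℚ.< ε →
  ∃ λ N → ∀ n → N ℕ.≤ n → seq x n ℚ.< seq y n ℚ.+ ε

_<_ : ℝ → ℝ → Set
x < y = ∃ λ ε → 0ℚ ℚ.< ε ×
  (∃ λ N → ∀ n → N ℕ.≤ n → seq x n ℚ.+ ε ℚ.< seq y n)

fromℚ : ℚ → ℝ
fromℚ q = mkℝ (λ _ → q) λ ε 0<ε →
  0 , λ _ _ _ _ → subst (λ r → ℚ.∣ r ∣ ℚ.< ε) (sym (ℚ.+-inverseʳ q)) 0<ε

fromℕ : ℕ → ℝ
fromℕ n = fromℚ (+ n ℚ./ 1)

0ℝ : ℝ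
0ℝ = fromℕ 0

abstract
  +-isCauchy : ∀ {x y} → IsCauchy x → IsCauchy y → IsCauchy (λ n → x n ℚ.+ y n)
  +-isCauchy {x} {y} cx cy ε 0<ε
    with cx (½ ℚ.* ε) (0<½p 0<ε) | cy (½ ℚ.* ε) (0<½p 0<ε)
  ... | M , hx | N , hy = M ℕ.⊔ N , λ m n m≥ n≥ →
    let hx′ = hx m n (ℕ.≤-trans (ℕ.m≤m⊔n M N) m≥) (ℕ.≤-trans (ℕ.m≤m⊔n M N) n≥)
        hy′ = hy m n (ℕ.≤-trans (ℕ.m≤n⊔m M N) m≥) (ℕ.≤-trans (ℕ.m≤n⊔m M N) n≥)
        a = x m ℚ.- x n
        b = y m ℚ.- y n
    in begin-strict
      ℚ.∣ (x m ℚ.+ y m) ℚ.- (x n ℚ.+ y n) ∣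
        ≡⟨ cong ℚ.∣_∣ (solve 4 (λ p q r s → (p :+ r) :- (q :+ s) := (p :- q) :+ (r :- s))
             refl (x m) (x n) (y m) (y n)) ⟩
      ℚ.∣ a ℚ.+ b ∣            ≤⟨ ℚ.∣p+q∣≤∣p∣+∣q∣ a b ⟩
      ℚ.∣ a ∣ ℚ.+ ℚ.∣ b ∣      <⟨ ℚ.+-mono-< hx′ hy′ ⟩
      ½ ℚ.* ε ℚ.+ ½ ℚ.* ε      ≡⟨ solve 1 (λ e → con ½ :* e :+ con ½ :* e := e) refl ε ⟩
      ε                        ∎
    where open ℚ.≤-Reasoning

  neg-isCauchy : ∀ {x} → IsCauchy x → IsCauchy (λ n → ℚ.- x n)
  neg-isCauchy {x} cx ε 0<ε with cx ε 0<ε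
  ... | N , h = N , λ m n m≥ n≥ → subst (ℚ._< ε)
    (trans (∣p-q∣≡∣q-p∣ (x m) (x n))
      (cong ℚ.∣_∣ (solve 2 (λ p q → q :- p := :- p :- :- q) refl (x m) (x n))))
    (h m n m≥ n≥)

  eventually-bounded : ∀ {x} → IsCauchy x →
    ∃ λ B → 0ℚ ℚ.< B × (∃ λ N → ∀ n → N ℕ.≤ n → ℚ.∣ x n ∣ ℚ.≤ B)
  eventually-bounded {x} cx with cx 1ℚ (ℚ.positive⁻¹ 1ℚ)
  ... | N , h = ℚ.∣ x N ∣ ℚ.+ 1ℚ , 0<B , N , λ n n≥ → begin
      ℚ.∣ x n ∣
        ≡⟨ cong ℚ.∣_∣ (solve 2 (λ p q → p := q :+ (p :- q)) refl (x n) (x N)) ⟩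
      ℚ.∣ x N ℚ.+ (x n ℚ.- x N) ∣
        ≤⟨ ℚ.∣p+q∣≤∣p∣+∣q∣ (x N) (x n ℚ.- x N) ⟩
      ℚ.∣ x N ∣ ℚ.+ ℚ.∣ x n ℚ.- x N ∣
        ≤⟨ ℚ.+-monoʳ-≤ ℚ.∣ x N ∣ (ℚ.<⇒≤ (h n N n≥ ℕ.≤-refl)) ⟩
      ℚ.∣ x N ∣ ℚ.+ 1ℚ ∎
    where
    open ℚ.≤-Reasoning
    0<B : 0ℚ ℚ.< ℚ.∣ x N ∣ ℚ.+ 1ℚ
    0<B = subst (ℚ._< ℚ.∣ x N ∣ ℚ.+ 1ℚ) (ℚ.+-identityʳ 0ℚ)
      (ℚ.+-mono-≤-< (ℚ.0≤∣p∣ (x N)) (ℚ.positive⁻¹ 1ℚ))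

  *-isCauchy : ∀ {x y} → IsCauchy x → IsCauchy y → IsCauchy (λ n → x n ℚ.* y n)
  *-isCauchy {x} {y} cx cy ε 0<ε =
    let A , 0<A , M₁ , bx = eventually-bounded {x} cx
        B , 0<B , M₂ , by = eventually-bounded {y} cy
        δ , 0<δ , eq = split ε A B 0<ε 0<A 0<B
        N₁ , hx = cx δ 0<δ
        N₂ , hy = cy δ 0<δ
    in (M₁ ℕ.⊔ M₂) ℕ.⊔ (N₁ ℕ.⊔ N₂) , λ m n m≥ n≥ →
    let ⊔≤m = ℕ.m⊔n≤o⇒m≤o (M₁ ℕ.⊔ M₂) _ m≥
        m≥′ = ℕ.m⊔n≤o⇒n≤o (M₁ ℕ.⊔ M₂) _ m≥
        ⊔≤n = ℕ.m⊔n≤o⇒m≤o (M₁ ℕ.⊔ M₂) _ n≥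
        n≥′ = ℕ.m⊔n≤o⇒n≤o (M₁ ℕ.⊔ M₂) _ n≥
    in ℚ.<-≤-trans
         (∣pr-qs∣< (x m) (x n) (y m) (y n) 0<A 0<B
           (bx m (ℕ.m⊔n≤o⇒m≤o M₁ M₂ ⊔≤m)) (by n (ℕ.m⊔n≤o⇒n≤o M₁ M₂ ⊔≤n))
           (hx m n (ℕ.m⊔n≤o⇒m≤o N₁ N₂ m≥′) (ℕ.m⊔n≤o⇒m≤o N₁ N₂ n≥′))
           (hy m n (ℕ.m⊔n≤o⇒n≤o N₁ N₂ m≥′) (ℕ.m⊔n≤o⇒n≤o N₁ N₂ n≥′)))
         (ℚ.≤-reflexive eq)

infixl 6 _+_ _-_
infixl 7 _*_
infix  8 -_

_+_ : ℝ → ℝ → ℝ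
x + y = mkℝ (λ n → seq x n ℚ.+ seq y n) (+-isCauchy {seq x} {seq y} (isCauchy x) (isCauchy y))

-_ : ℝ → ℝ
- x = mkℝ (λ n → ℚ.- seq x n) (neg-isCauchy {seq x} (isCauchy x))

_-_ : ℝ → ℝ → ℝ
x - y = x + (- y)

_*_ : ℝ → ℝ → ℝ
x * y = mkℝ (λ n → seq x n ℚ.* seq y n) (*-isCauchy {seq x} {seq y} (isCauchy x) (isCauchy y))

-- the integer part of the square root
isqrt : ℕ → ℕ
isqrt zero    = 0
isqrt (suc n) with suc (isqrt n) ℕ.* suc (isqrt n) ℕ.≤? suc n
... | yes _ = suc (isqrt n)
... | no  _ = isqrt n

isqrt-spec : ∀ n →
  isqrt n ℕ.* isqrt n ℕ.≤ n × n ℕ.< suc (isqrt n) ℕ.* suc (isqrt n)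
isqrt-spec zero = ℕ.z≤n , ℕ.s≤s ℕ.z≤n
isqrt-spec (suc n) with suc (isqrt n) ℕ.* suc (isqrt n) ℕ.≤? suc n
... | yes p = p , ℕ.≤-<-trans (proj₂ (isqrt-spec n)) (ℕ.*-mono-< n<1+n n<1+n)
  where
  n<1+n : suc (isqrt n) ℕ.< suc (suc (isqrt n))
  n<1+n = ℕ.n<1+n (suc (isqrt n))
... | no ¬p = ℕ.m≤n⇒m≤1+n (proj₁ (isqrt-spec n)) , ℕ.≰⇒> ¬p

-- the integer part of q(n+1)², for q ≥ 0
scaled : ℕ → ℚ → ℕ
scaled n q = ℤ.∣ ↥ q ∣ ℕ.* (suc n ℕ.* suc n) ℕ./ ↧ₙ q

-- the greatest multiple of 1/(n+1) whose square is at most max(q,0)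
rationalRoot : ℕ → ℚ → ℚ
rationalRoot n q = + isqrt (scaled n (q ℚ.⊔ 0ℚ)) ℚ./ suc n

toℚᵘ-/ : ∀ r n → ℚ.toℚᵘ (+ r ℚ./ suc n) ℚᵘ.≃ ℚᵘ.mkℚᵘ (+ r) n
toℚᵘ-/ r n = ℚ.toℚᵘ-fromℚᵘ (ℚᵘ.mkℚᵘ (+ r) n)

toℚᵘ-square : ∀ r n →
  ℚ.toℚᵘ ((+ r ℚ./ suc n) ℚ.* (+ r ℚ./ suc n)) ℚᵘ.≃ ℚᵘ.mkℚᵘ (+ r) n ℚᵘ.* ℚᵘ.mkℚᵘ (+ r) n
toℚᵘ-square r n = ℚᵘ.≃-trans (ℚ.toℚᵘ-homo-* (+ r ℚ./ suc n) (+ r ℚ./ suc n))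
  (ℚᵘ.*-cong (toℚᵘ-/ r n) (toℚᵘ-/ r n))

suc-/ : ∀ r n → + suc r ℚ./ suc n ≡ (+ r ℚ./ suc n) ℚ.+ (+ 1 ℚ./ suc n)
suc-/ r n = ℚ.toℚᵘ-injective (ℚᵘ.≃-trans (toℚᵘ-/ (suc r) n) (ℚᵘ.≃-trans eq (ℚᵘ.≃-sym
  (ℚᵘ.≃-trans (ℚ.toℚᵘ-homo-+ (+ r ℚ./ suc n) (+ 1 ℚ./ suc n))
    (ℚᵘ.+-cong (toℚᵘ-/ r n) (toℚᵘ-/ 1 n))))))
  where
  nat : ∀ r k → (1 ℕ.+ r) ℕ.* (k ℕ.* k) ≡ (r ℕ.* k ℕ.+ 1 ℕ.* k) ℕ.* k
  nat = ℕ-Ring.solve-∀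
  eq : ℚᵘ.mkℚᵘ (+ suc r) n ℚᵘ.≃ ℚᵘ.mkℚᵘ (+ r) n ℚᵘ.+ ℚᵘ.mkℚᵘ (+ 1) n
  eq = ℚᵘ.*≡* (trans (sym (ℤ.pos-* (suc r) (suc n ℕ.* suc n)))
    (trans (cong +_ (nat r (suc n)))
      (trans (ℤ.pos-* (r ℕ.* suc n ℕ.+ 1 ℕ.* suc n) (suc n))
        (cong (ℤ._* + suc n) (cong₂ ℤ._+_ (ℤ.pos-* r (suc n)) (ℤ.pos-* 1 (suc n)))))))

square-/-≤ : ∀ r n q → 0ℚ ℚ.≤ q → r ℕ.* r ℕ.* ↧ₙ q ℕ.≤ ℤ.∣ ↥ q ∣ ℕ.* (suc n ℕ.* suc n) →
  (+ r ℚ./ suc n) ℚ.* (+ r ℚ./ suc n) ℚ.≤ q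
square-/-≤ r n q@(ℚ.mkℚ (+ p) d-1 _) 0≤q h = ℚ.toℚᵘ-cancel-≤
  (ℚᵘ.≤-respˡ-≃ (ℚᵘ.≃-sym (toℚᵘ-square r n)) (ℚᵘ.*≤* (subst₂ ℤ._≤_
    (trans (ℤ.pos-* (r ℕ.* r) (suc d-1)) (cong (ℤ._* + suc d-1) (ℤ.pos-* r r)))
    (ℤ.pos-* p (suc n ℕ.* suc n)) (ℤ.+≤+ h))))
square-/-≤ r n (ℚ.mkℚ ℤ.-[1+ _ ] _ _) (ℚ.*≤* ())

square-/-> : ∀ r n q → 0ℚ ℚ.≤ q → ℤ.∣ ↥ q ∣ ℕ.* (suc n ℕ.* suc n) ℕ.< r ℕ.* r ℕ.* ↧ₙ q →
  q ℚ.< (+ r ℚ./ suc n) ℚ.* (+ r ℚ./ suc n)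
square-/-> r n q@(ℚ.mkℚ (+ p) d-1 _) 0≤q h = ℚ.toℚᵘ-cancel-<
  (ℚᵘ.<-respʳ-≃ (ℚᵘ.≃-sym (toℚᵘ-square r n)) (ℚᵘ.*<* (subst₂ ℤ._<_
    (ℤ.pos-* p (suc n ℕ.* suc n))
    (trans (ℤ.pos-* (r ℕ.* r) (suc d-1)) (cong (ℤ._* + suc d-1) (ℤ.pos-* r r)))
    (ℤ.+<+ h))))
square-/-> r n (ℚ.mkℚ ℤ.-[1+ _ ] _ _) (ℚ.*≤* ())

0≤/ : ∀ r n → 0ℚ ℚ.≤ + r ℚ./ suc n
0≤/ r n = ℚ.nonNegative⁻¹ (+ r ℚ./ suc n) {{ℚ.normalize-nonNeg r (suc n)}}

rationalRoot-≥0 : ∀ n q → 0ℚ ℚ.≤ rationalRoot n q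
rationalRoot-≥0 n q = 0≤/ (isqrt (scaled n (q ℚ.⊔ 0ℚ))) n

rationalRoot-lower : ∀ n q → rationalRoot n q ℚ.* rationalRoot n q ℚ.≤ q ℚ.⊔ 0ℚ
rationalRoot-lower n q = lower (q ℚ.⊔ 0ℚ) (ℚ.p≤q⊔p q 0ℚ)
  where
  lower : ∀ q → 0ℚ ℚ.≤ q →
    (+ isqrt (scaled n q) ℚ./ suc n) ℚ.* (+ isqrt (scaled n q) ℚ./ suc n) ℚ.≤ q
  lower q 0≤q = square-/-≤ (isqrt t) n q 0≤q
    (ℕ.≤-trans (ℕ.*-monoˡ-≤ (↧ₙ q) (proj₁ (isqrt-spec t))) (ℕ.m/n*n≤m s (↧ₙ q)))
    where
    s = ℤ.∣ ↥ q ∣ ℕ.* (suc n ℕ.* suc n)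
    t = scaled n q

rationalRoot-upper : ∀ n q →
  q ℚ.⊔ 0ℚ ℚ.< (rationalRoot n q ℚ.+ (+ 1 ℚ./ suc n)) ℚ.* (rationalRoot n q ℚ.+ (+ 1 ℚ./ suc n))
rationalRoot-upper n q = subst (λ v → q ℚ.⊔ 0ℚ ℚ.< v ℚ.* v)
  (suc-/ (isqrt (scaled n (q ℚ.⊔ 0ℚ))) n) (upper (q ℚ.⊔ 0ℚ) (ℚ.p≤q⊔p q 0ℚ))
  where
  upper : ∀ q → 0ℚ ℚ.≤ q →
    q ℚ.< (+ suc (isqrt (scaled n q)) ℚ./ suc n) ℚ.* (+ suc (isqrt (scaled n q)) ℚ./ suc n)
  upper q 0≤q = square-/-> (suc (isqrt t)) n q 0≤q
    (ℕ.<-≤-trans s<[1+t]*d (ℕ.*-monoˡ-≤ (↧ₙ q) (proj₂ (isqrt-spec t))))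
    where
    s = ℤ.∣ ↥ q ∣ ℕ.* (suc n ℕ.* suc n)
    t = scaled n q
    s<[1+t]*d : s ℕ.< suc t ℕ.* ↧ₙ q
    s<[1+t]*d = subst (ℕ._< suc t ℕ.* ↧ₙ q) (sym (ℕ.m≡m%n+[m/n]*n s (↧ₙ q)))
      (ℕ.+-monoˡ-< (t ℕ.* ↧ₙ q) (ℕ.m%n<n s (↧ₙ q)))

archimedean : ∀ ε → 0ℚ ℚ.< ε → ∀ n → ↧ₙ ε ℕ.≤ n → + 1 ℚ./ suc n ℚ.≤ ε
archimedean (ℚ.mkℚ ℤ.-[1+ _ ] _ _) (ℚ.*<* ()) n h
archimedean (ℚ.mkℚ (+ zero) _ _) (ℚ.*<* (ℤ.+<+ ())) n h
archimedean (ℚ.mkℚ (+ suc p) d-1 _) _ n h = ℚ.toℚᵘ-cancel-≤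
  (ℚᵘ.≤-respˡ-≃ (ℚᵘ.≃-sym (toℚᵘ-/ 1 n)) (ℚᵘ.*≤* (subst₂ ℤ._≤_
    (ℤ.pos-* 1 (suc d-1)) (ℤ.pos-* (suc p) (suc n))
    (ℤ.+≤+ (ℕ.*-mono-≤ {1} {suc p} (ℕ.s≤s ℕ.z≤n) (ℕ.m≤n⇒m≤1+n h))))))

roots-close : ∀ p q u v e h → 0ℚ ℚ.≤ v → 0ℚ ℚ.≤ e → 0ℚ ℚ.≤ h → e ℚ.≤ h →
  u ℚ.* u ℚ.≤ p ℚ.⊔ 0ℚ → q ℚ.⊔ 0ℚ ℚ.< (v ℚ.+ e) ℚ.* (v ℚ.+ e) →
  p ℚ.< q ℚ.+ h ℚ.* h → u ℚ.< (v ℚ.+ h) ℚ.+ h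
roots-close p q u v e h 0≤v 0≤e 0≤h e≤h lower upper p<q =
  square-cancel-< {u} {w ℚ.+ h} (0≤+ w h 0≤w 0≤h) (begin-strict
    u ℚ.* u                                ≤⟨ lower ⟩
    p ℚ.⊔ 0ℚ                               ≤⟨ p⁺≤ ⟩
    q ℚ.⊔ 0ℚ ℚ.+ h ℚ.* h                   <⟨ ℚ.+-monoˡ-< (h ℚ.* h) upper ⟩
    (v ℚ.+ e) ℚ.* (v ℚ.+ e) ℚ.+ h ℚ.* h    ≤⟨ ℚ.+-monoˡ-≤ (h ℚ.* h)
                                              (*-mono-≤ {v ℚ.+ e} {w} {v ℚ.+ e} {w}
                                                (0≤+ v e 0≤v 0≤e) 0≤w v+e≤w v+e≤w) ⟩
    w ℚ.* w ℚ.+ h ℚ.* h                    ≡⟨ sym (ℚ.+-identityʳ (w ℚ.* w ℚ.+ h ℚ.* h)) ⟩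
    (w ℚ.* w ℚ.+ h ℚ.* h) ℚ.+ 0ℚ           ≤⟨ ℚ.+-monoʳ-≤ (w ℚ.* w ℚ.+ h ℚ.* h)
                                              (0≤+ (w ℚ.* h) (w ℚ.* h) 0≤wh 0≤wh) ⟩
    (w ℚ.* w ℚ.+ h ℚ.* h) ℚ.+ (w ℚ.* h ℚ.+ w ℚ.* h)
      ≡⟨ solve 2 (λ w h → (w :* w :+ h :* h) :+ (w :* h :+ w :* h) := (w :+ h) :* (w :+ h))
           refl w h ⟩
    (w ℚ.+ h) ℚ.* (w ℚ.+ h) ∎)
  where
  open ℚ.≤-Reasoning
  w : ℚ
  w = v ℚ.+ h
  0≤+ : ∀ a b → 0ℚ ℚ.≤ a → 0ℚ ℚ.≤ b → 0ℚ ℚ.≤ a ℚ.+ b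
  0≤+ a b 0≤a 0≤b = subst (ℚ._≤ a ℚ.+ b) (ℚ.+-identityʳ 0ℚ) (ℚ.+-mono-≤ 0≤a 0≤b)
  0≤* : ∀ a b → 0ℚ ℚ.≤ a → 0ℚ ℚ.≤ b → 0ℚ ℚ.≤ a ℚ.* b
  0≤* a b 0≤a 0≤b = subst (ℚ._≤ a ℚ.* b) (ℚ.*-zeroʳ 0ℚ)
    (*-mono-≤ {0ℚ} {a} {0ℚ} {b} ℚ.≤-refl 0≤b 0≤a 0≤b)
  0≤w : 0ℚ ℚ.≤ w
  0≤w = 0≤+ v h 0≤v 0≤h
  0≤wh : 0ℚ ℚ.≤ w ℚ.* h
  0≤wh = 0≤* w h 0≤w 0≤h
  v+e≤w : v ℚ.+ e ℚ.≤ w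
  v+e≤w = ℚ.+-monoʳ-≤ v e≤h
  p⁺≤ : p ℚ.⊔ 0ℚ ℚ.≤ q ℚ.⊔ 0ℚ ℚ.+ h ℚ.* h
  p⁺≤ = ℚ.⊔-lub
    (ℚ.≤-trans (ℚ.<⇒≤ p<q) (ℚ.+-monoˡ-≤ (h ℚ.* h) (ℚ.p≤p⊔q q 0ℚ)))
    (0≤+ (q ℚ.⊔ 0ℚ) (h ℚ.* h) (ℚ.p≤q⊔p q 0ℚ) (0≤* h h 0≤h 0≤h))

rationalRoot-close : ∀ m n p q ε → 0ℚ ℚ.< ε → + 1 ℚ./ suc n ℚ.≤ ½ ℚ.* ε →
  p ℚ.< q ℚ.+ (½ ℚ.* ε) ℚ.* (½ ℚ.* ε) → rationalRoot m p ℚ.< rationalRoot n q ℚ.+ ε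
rationalRoot-close m n p q ε 0<ε 1/n≤h p<q = subst (rationalRoot m p ℚ.<_)
  (halves (rationalRoot n q) ε)
  (roots-close p q (rationalRoot m p) (rationalRoot n q) (+ 1 ℚ./ suc n) (½ ℚ.* ε)
    (rationalRoot-≥0 n q) (0≤/ 1 n) (ℚ.<⇒≤ (0<½p 0<ε)) 1/n≤h
    (rationalRoot-lower m p) (rationalRoot-upper n q) p<q)
  where
  halves : ∀ v ε → (v ℚ.+ ½ ℚ.* ε) ℚ.+ ½ ℚ.* ε ≡ v ℚ.+ ε
  halves = solve 2 (λ v ε → (v :+ con ½ :* ε) :+ con ½ :* ε := v :+ ε) refl

abstract
  √-isCauchy : ∀ {x} → IsCauchy x → IsCauchy (λ n → rationalRoot n (x n))
  √-isCauchy {x} cx ε 0<ε =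
    let h     = ½ ℚ.* ε
        0<h   = 0<½p 0<ε
        N , c = cx (h ℚ.* h) (0<p*q 0<h 0<h)
    in N ℕ.⊔ ↧ₙ h , λ m n m≥ n≥ →
    let m≥N = ℕ.m⊔n≤o⇒m≤o N (↧ₙ h) m≥
        n≥N = ℕ.m⊔n≤o⇒m≤o N (↧ₙ h) n≥
        m≥h = ℕ.m⊔n≤o⇒n≤o N (↧ₙ h) m≥
        n≥h = ℕ.m⊔n≤o⇒n≤o N (↧ₙ h) n≥
    in p<q+r⇒∣p-q∣<r (rationalRoot m (x m)) (rationalRoot n (x n)) ε
         (rationalRoot-close m n (x m) (x n) ε 0<ε (archimedean h 0<h n n≥h)
           (∣p-q∣<r⇒p<q+r (x m) (x n) _ (c m n m≥N n≥N)))
         (rationalRoot-close n m (x n) (x m) ε 0<ε (archimedean h 0<h m m≥h)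
           (∣p-q∣<r⇒p<q+r (x n) (x m) _ (c n m n≥N m≥N)))

-- the nonnegative square root of max(x,0); the nth term is within 1/(n+1) of the
-- root of the nth term of max(x,0)
√ : ℝ → ℝ
√ x = mkℝ (λ n → rationalRoot n (seq x n)) (√-isCauchy {seq x} (isCauchy x))

record ℂ : Set where
  constructor _+i_
  field
    re im : ℝ

open ℂ public

infix  4 _≈ℂ_
infixl 6 _+ℂ_
infixl 7 _*ℂ_

_≈ℂ_ : ℂ → ℂ → Set
z ≈ℂ w = (re z ≈ re w) × (im z ≈ im w)

_+ℂ_ : ℂ → ℂ → ℂ
z +ℂ w = (re z + re w) +i (im z + im w)

_*ℂ_ : ℂ → ℂ → ℂ
z *ℂ w = (re z * re w - im z * im w) +i (re z * im w + im z * re w)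

ℕ→ℂ : ℕ → ℂ
ℕ→ℂ n = fromℕ n +i 0ℝ

modulus : ℂ → ℝ
modulus z = √ (re z * re z + im z * im z)

+ℂ-rawMonoid : RawMonoid 0ℓ 0ℓ
+ℂ-rawMonoid = record { Carrier = ℂ ; _≈_ = _≈ℂ_ ; _∙_ = _+ℂ_ ; ε = ℕ→ℂ 0 }

Matrix : Set → ℕ → Set
Matrix A n = Vector (Vector A n) n

_·_ : ∀ {n} → Matrix ℂ n → Vector ℂ n → Vector ℂ n
(M · x) i = Sum.sum +ℂ-rawMonoid λ j → M i j *ℂ x j

IsEigenvalue : ∀ {n} → Matrix ℂ n → ℂ → Set
IsEigenvalue {n} M z = Σ (Vector ℂ n) λ x →
  ¬ (∀ i → x i ≈ℂ ℕ→ℂ 0) × (∀ i → (M · x) i ≈ℂ z *ℂ x i)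

-- ρ is the greatest modulus of a complex eigenvalue; it is unique up to _≈_
IsSpectralRadius : ∀ {n} → Matrix ℂ n → ℝ → Set
IsSpectralRadius M ρ =
  (Σ ℂ λ z → IsEigenvalue M z × modulus z ≈ ρ) ×
  (∀ z → IsEigenvalue M z → modulus z ≤ ρ)

record Digraph (n : ℕ) : Set where
  field
    arc      : Fin n → Fin n → Bool
    loopless : ∀ i → arc i i ≡ false

open Digraph public

_≅_ : ∀ {n} → Digraph n → Digraph n → Set
_≅_ {n} D E = Σ (Permutation′ n) λ π →
  ∀ i j → arc D i j ≡ arc E (π ⟨$⟩ʳ i) (π ⟨$⟩ʳ j)

StronglyConnected : ∀ {n} → Digraph n → Set
StronglyConnected D = ∀ i j → Star (λ u v → T (arc D u v)) i j

complete : ∀ n → Digraph n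
complete n = record
  { arc      = λ i j → not (does (i Fin.≟ j))
  ; loopless = loopless′
  }
  where
  loopless′ : ∀ (i : Fin n) → not (does (i Fin.≟ i)) ≡ false
  loopless′ i with i Fin.≟ i
  ... | yes _   = refl
  ... | no  i≢i = contradiction refl i≢i

deleteArc : ∀ {n} → Digraph n → Fin n → Fin n → Digraph n
deleteArc D u v = record
  { arc      = λ i j → arc D i j ∧ not (does (i Fin.≟ u) ∧ does (j Fin.≟ v))
  ; loopless = λ i → cong (_∧ not (does (i Fin.≟ u) ∧ does (i Fin.≟ v))) (loopless D i)
  }

-- D is isomorphic to K(n,n-2,1). Deleting any arc (u,v) from the complete digraph
-- gives the same digraph up to isomorphism, so none is singled out.
IsCompleteMinusArc : ∀ {n} → Digraph n → Set
IsCompleteMinusArc {n} D = ∃₂ λ u v → u ≢ v × D ≅ deleteArc (complete n) u v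

adjacency : ∀ {n} → Digraph n → Matrix ℕ n
adjacency D i j = if arc D i j then 1 else 0

outdegree : ∀ {n} → Digraph n → Vector ℕ n
outdegree D i = Sum.sum ℕ.+-0-rawMonoid (adjacency D i)

diag : ∀ {n} → Vector ℕ n → Matrix ℕ n
diag d i j = if does (i Fin.≟ j) then d i else 0

signlessLaplacian : ∀ {n} → Digraph n → Matrix ℂ n
signlessLaplacian D i j = ℕ→ℂ (diag (outdegree D) i j ℕ.+ adjacency D i j)

{-# OPTIONS --safe #-}

-- D misses at least two arcs (u,v) ≠ (u′,v′) of the complete digraph. Let mᵢ be the
-- number of these two arcs with tail i and wᵢ = n + 2 − 2mᵢ > 0. Then Q(D) w ≤ r w
-- entrywise with r = (2n² + 2n − 8)/(n + 2), so every eigenvalue of Q(D) has modulus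
-- at most r, while r is below the bound by at least 1/(2(n + 2)): the bound is
-- (3n − 5 + √c)/2 with c = n² + 2n − 7, and √c ≥ (n² + 3n − 5)/(n + 2) for n ≥ 3.
module Submission where

open import Defs
open import Data.Nat using (ℕ; zero; suc) renaming (_≤_ to _≤ℕ_)
open import Data.Rational using (ℚ; 0ℚ; 1ℚ; ½; ↧ₙ_)
open import Relation.Nullary using (¬_; Dec; does; yes; no; contradiction)

open import Algebra.Bundles using (CommutativeRing)
import Algebra.Definitions.RawMonoid as Sum
import Algebra.Properties.Semiring.Sum as SemiringSum
open import Data.Bool using (true; false; not; if_then_else_)
import Data.Bool.Properties as Bool
open import Data.Fin using (Fin; zero; suc)
import Data.Fin.Permutation as Perm
import Data.Fin.Properties as Fin
open import Data.Integer using (+_)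
import Data.Nat as ℕ
import Data.Nat.Properties as ℕ
open import Data.Nat.Tactic.RingSolver using (solve-∀)
open import Data.Product using (∃; ∃₂; _×_; _,_; proj₁; proj₂)
import Data.Rational as ℚ
import Data.Rational.Properties as ℚ
open import Data.Rational.Solver using (module +-*-Solver)
open import Data.Sum using (_⊎_; inj₁; inj₂)
open import Function using (_∘_)
open import Relation.Binary.PropositionalEquality
open import Relation.Nullary.Decidable using (¬?; _×-dec_)

open +-*-Solver using (solve; _:+_; _:*_; _:-_; :-_; _:=_; con)

-- The modulus bound is a contraction in the norm max |xᵢ|/wᵢ: at an index attaining the maximum,
-- |z||xᵢ| ≤ r|xᵢ|. The weights arise as follows. Scale them to 1 - t mᵢ. If only two arcs are
-- missing, a row without a tail forces r ≥ 2n - 2 - 2t, so t should be large; the rows with one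
-- tail (at the least possible head weight) and with two tails both reduce to (n + 2)t ≤ 2 + 2t².
-- Dropping the quadratic term gives t = 2/(n + 2). Further missing arcs only lower a nonnegative
-- matrix, so two suffice. The obstacle is that reals are Cauchy sequences: a maximal |xᵢ|/wᵢ cannot
-- be selected, an eigenvector is nonzero only in the negated sense, and its equation holds termwise
-- only up to an error. So the maximal index is chosen anew at each rational term, and the argument
-- is by contradiction: if the modulus stayed above r by a fixed gap, every entry would tend to 0.
-- Squared moduli keep this within rational arithmetic.

module Σℕ = SemiringSum ℕ.+-*-semiring

-- Finite sums of natural numbers and the Kronecker delta.

Σℕ-mono : ∀ {n} {f g : Fin n → ℕ} → (∀ i → f i ≤ℕ g i) → Σℕ.sum f ≤ℕ Σℕ.sum g
Σℕ-mono {zero}  f≤g = ℕ.z≤n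
Σℕ-mono {suc n} f≤g = ℕ.+-mono-≤ (f≤g zero) (Σℕ-mono (f≤g ∘ suc))

Σℕ-const : ∀ n c → Σℕ.sum {n} (λ _ → c) ≡ n ℕ.* c
Σℕ-const zero    c = refl
Σℕ-const (suc n) c = cong (c ℕ.+_) (Σℕ-const n c)

δ : ∀ {n} → Fin n → Fin n → ℕ
δ i j = if does (i Fin.≟ j) then 1 else 0

δ-refl : ∀ {n} (i : Fin n) → δ i i ≡ 1
δ-refl i with i Fin.≟ i
... | yes _   = refl
... | no  i≢i = contradiction refl i≢i

δ-≢ : ∀ {n} {i j : Fin n} → i ≢ j → δ i j ≡ 0
δ-≢ {i = i} {j} i≢j with i Fin.≟ j
... | yes i≡j = contradiction i≡j i≢j
... | no  _   = refl

Σ-δ : ∀ {n} (i : Fin n) (f : Fin n → ℕ) → Σℕ.sum (λ j → δ i j ℕ.* f j) ≡ f i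
Σ-δ {suc n} zero f = trans
  (cong₂ ℕ._+_ (ℕ.*-identityˡ (f zero)) (Σℕ.sum-replicate-zero n))
  (ℕ.+-identityʳ (f zero))
Σ-δ {suc n} (suc i) f = Σ-δ i (f ∘ suc)

-- Two missing arcs.

Missing : ∀ {n} → Digraph n → Fin n → Fin n → Set
Missing D i j = i ≢ j × arc D i j ≡ false

missing? : ∀ {n} (D : Digraph n) i j → Dec (Missing D i j)
missing? D i j = ¬? (i Fin.≟ j) ×-dec (arc D i j Bool.≟ false)

-- Being missing is decidable and there are finitely many pairs, so a search separates the cases.
-- With no missing arc, or exactly one, `D` has the very arcs of an excluded digraph and the
-- identity permutation is an isomorphism.
two-missing : ∀ {n} (D : Digraph n) → ¬ (D ≅ complete n) → ¬ IsCompleteMinusArc D →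
  ∃₂ λ u v → Missing D u v × (∃₂ λ u′ v′ → Missing D u′ v′ × ¬ (u ≡ u′ × v ≡ v′))
two-missing {n} D ≇K ≇K-arc with Fin.any? (λ u → Fin.any? (λ v → missing? D u v))
... | no none = contradiction (Perm.id , same) ≇K
  where
  same : ∀ i j → arc D i j ≡ not (does (i Fin.≟ j))
  same i j with i Fin.≟ j
  ... | yes refl = loopless D i
  ... | no i≢j = Bool.¬-not λ ¬arc → none (i , j , i≢j , ¬arc)
... | yes (u , v , uv@(u≢v , ¬arc-uv))
  with Fin.any? (λ i → Fin.any? (λ j → missing? D i j ×-dec ¬? ((u Fin.≟ i) ×-dec (v Fin.≟ j))))
... | yes (u′ , v′ , u′v′ , distinct) = u , v , uv , u′ , v′ , u′v′ , distinct
... | no none = contradiction (u , v , u≢v , Perm.id , same) ≇K-arc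
  where
  same : ∀ i j → arc D i j ≡ arc (deleteArc (complete n) u v) i j
  same i j with i Fin.≟ j
  ... | yes refl = loopless D i
  ... | no i≢j with i Fin.≟ u | j Fin.≟ v
  ...   | yes refl | yes refl = ¬arc-uv
  ...   | yes refl | no j≢v   = Bool.¬-not λ ¬arc →
    none (i , j , (i≢j , ¬arc) , λ (_ , v≡j) → j≢v (sym v≡j))
  ...   | no i≢u   | _        = Bool.¬-not λ ¬arc →
    none (i , j , (i≢j , ¬arc) , λ (u≡i , _) → i≢u (sym u≡i))

-- Weighted rows of the signless Laplacian.

Q : ∀ {n} → Digraph n → Matrix ℕ n
Q D i j = diag (outdegree D) i j ℕ.+ adjacency D i j

-- The outdegree counts the arcs leaving `i`, so the diagonal term contributes one `v i` per arc.
Q-apply : ∀ {n} (D : Digraph n) (v : Fin n → ℕ) i →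
  Σℕ.sum (λ j → Q D i j ℕ.* v j) ≡ Σℕ.sum (λ j → adjacency D i j ℕ.* (v i ℕ.+ v j))
Q-apply {n} D v i = begin
  Σℕ.sum (λ j → Q D i j ℕ.* v j)
    ≡⟨ Σℕ.sum-cong-≗ {n} (λ j → trans
         (ℕ.*-distribʳ-+ (v j) (diag (outdegree D) i j) (A j))
         (cong (ℕ._+ A j ℕ.* v j) (diag-* j))) ⟩
  Σℕ.sum (λ j → δ i j ℕ.* (d ℕ.* v j) ℕ.+ A j ℕ.* v j)
    ≡⟨ Σℕ.∑-distrib-+ {n} (λ j → δ i j ℕ.* (d ℕ.* v j)) (λ j → A j ℕ.* v j) ⟩
  Σℕ.sum (λ j → δ i j ℕ.* (d ℕ.* v j)) ℕ.+ Σℕ.sum (λ j → A j ℕ.* v j)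
    ≡⟨ cong (ℕ._+ Σℕ.sum (λ j → A j ℕ.* v j)) (Σ-δ i (λ j → d ℕ.* v j)) ⟩
  d ℕ.* v i ℕ.+ Σℕ.sum (λ j → A j ℕ.* v j)
    ≡⟨ cong (ℕ._+ Σℕ.sum (λ j → A j ℕ.* v j)) (Σℕ.*-distribʳ-sum (v i) A) ⟩
  Σℕ.sum (λ j → A j ℕ.* v i) ℕ.+ Σℕ.sum (λ j → A j ℕ.* v j)
    ≡⟨ Σℕ.∑-distrib-+ {n} (λ j → A j ℕ.* v i) (λ j → A j ℕ.* v j) ⟨
  Σℕ.sum (λ j → A j ℕ.* v i ℕ.+ A j ℕ.* v j)
    ≡⟨ Σℕ.sum-cong-≗ {n} (λ j → sym (ℕ.*-distribˡ-+ (A j) (v i) (v j))) ⟩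
  Σℕ.sum (λ j → A j ℕ.* (v i ℕ.+ v j)) ∎
  where
  open ≡-Reasoning
  A = adjacency D i
  d = outdegree D i
  diag-* : ∀ j → diag (outdegree D) i j ℕ.* v j ≡ δ i j ℕ.* (d ℕ.* v j)
  diag-* j with does (i Fin.≟ j)
  ... | true  = sym (ℕ.*-identityˡ (d ℕ.* v j))
  ... | false = refl

slack-≤ : ∀ {m n} s → m ℕ.+ s ≡ n → m ≤ℕ n
slack-≤ {m} s refl = ℕ.m≤m+n m s

-- X is the entry of Q(D) w, for n = 3 + k, in a row that is the tail of no, one or both
-- missing arcs; s is the weight of the head of the missing arc.

row-no-tail : ∀ k X →
  X ℕ.+ 2 ℕ.* (5 ℕ.+ k) ℕ.+ 4 ≤ℕ (3 ℕ.+ k) ℕ.* (5 ℕ.+ k) ℕ.+ (3 ℕ.+ k) ℕ.* (5 ℕ.+ k) →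
  (5 ℕ.+ k) ℕ.* X ≤ℕ (2 ℕ.* k ℕ.* k ℕ.+ 14 ℕ.* k ℕ.+ 16) ℕ.* (5 ℕ.+ k)
row-no-tail k X h = subst ((5 ℕ.+ k) ℕ.* X ≤ℕ_) (ℕ.*-comm (5 ℕ.+ k) (2 ℕ.* k ℕ.* k ℕ.+ 14 ℕ.* k ℕ.+ 16))
  (ℕ.*-monoʳ-≤ (5 ℕ.+ k) {X} (ℕ.+-cancelʳ-≤ (2 ℕ.* k ℕ.+ 14) X
    (2 ℕ.* k ℕ.* k ℕ.+ 14 ℕ.* k ℕ.+ 16)
    (subst₂ _≤ℕ_ (lhs k X) (rhs k) h)))
  where
  lhs : ∀ k X → X ℕ.+ 2 ℕ.* (5 ℕ.+ k) ℕ.+ 4 ≡ X ℕ.+ (2 ℕ.* k ℕ.+ 14)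
  lhs = solve-∀
  rhs : ∀ k → (3 ℕ.+ k) ℕ.* (5 ℕ.+ k) ℕ.+ (3 ℕ.+ k) ℕ.* (5 ℕ.+ k) ≡
    (2 ℕ.* k ℕ.* k ℕ.+ 14 ℕ.* k ℕ.+ 16) ℕ.+ (2 ℕ.* k ℕ.+ 14)
  rhs = solve-∀

row-one-tail : ∀ k X s → 3 ℕ.+ k ≤ℕ s →
  X ℕ.+ 2 ℕ.* (3 ℕ.+ k) ℕ.+ (3 ℕ.+ k ℕ.+ s) ℕ.+ 4 ≤ℕ
    (3 ℕ.+ k) ℕ.* (3 ℕ.+ k) ℕ.+ (3 ℕ.+ k) ℕ.* (5 ℕ.+ k) →
  (5 ℕ.+ k) ℕ.* X ≤ℕ (2 ℕ.* k ℕ.* k ℕ.+ 14 ℕ.* k ℕ.+ 16) ℕ.* (3 ℕ.+ k)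
row-one-tail k X s s≥ h = ℕ.≤-trans
  (ℕ.*-monoʳ-≤ (5 ℕ.+ k) {X} (ℕ.+-cancelʳ-≤ (4 ℕ.* k ℕ.+ 16) X
    (2 ℕ.* k ℕ.* k ℕ.+ 10 ℕ.* k ℕ.+ 8)
    (subst₂ _≤ℕ_ (lhs k X) (rhs k) (ℕ.≤-trans
      (ℕ.+-monoˡ-≤ 4 (ℕ.+-monoʳ-≤ (X ℕ.+ 2 ℕ.* (3 ℕ.+ k)) (ℕ.+-monoʳ-≤ (3 ℕ.+ k) s≥))) h))))
  -- In terms of n: (n + 2)(2n² - 2n - 4) + 8 = (2n² + 2n - 8)n. With t = 2/(n + 2), the 8 is the
  -- dropped 2t² times (n + 2)².
  (slack-≤ {(5 ℕ.+ k) ℕ.* (2 ℕ.* k ℕ.* k ℕ.+ 10 ℕ.* k ℕ.+ 8)} 8 (slack k))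
  where
  lhs : ∀ k X → X ℕ.+ 2 ℕ.* (3 ℕ.+ k) ℕ.+ (3 ℕ.+ k ℕ.+ (3 ℕ.+ k)) ℕ.+ 4 ≡
    X ℕ.+ (4 ℕ.* k ℕ.+ 16)
  lhs = solve-∀
  rhs : ∀ k → (3 ℕ.+ k) ℕ.* (3 ℕ.+ k) ℕ.+ (3 ℕ.+ k) ℕ.* (5 ℕ.+ k) ≡
    (2 ℕ.* k ℕ.* k ℕ.+ 10 ℕ.* k ℕ.+ 8) ℕ.+ (4 ℕ.* k ℕ.+ 16)
  rhs = solve-∀
  slack : ∀ k → (5 ℕ.+ k) ℕ.* (2 ℕ.* k ℕ.* k ℕ.+ 10 ℕ.* k ℕ.+ 8) ℕ.+ 8 ≡
    (2 ℕ.* k ℕ.* k ℕ.+ 14 ℕ.* k ℕ.+ 16) ℕ.* (3 ℕ.+ k)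
  slack = solve-∀

row-two-tails : ∀ k X →
  X ℕ.+ 2 ℕ.* (1 ℕ.+ k) ℕ.+ 2 ℕ.* (1 ℕ.+ k ℕ.+ (5 ℕ.+ k)) ℕ.+ 4 ≤ℕ
    (3 ℕ.+ k) ℕ.* (1 ℕ.+ k) ℕ.+ (3 ℕ.+ k) ℕ.* (5 ℕ.+ k) →
  (5 ℕ.+ k) ℕ.* X ≤ℕ (2 ℕ.* k ℕ.* k ℕ.+ 14 ℕ.* k ℕ.+ 16) ℕ.* (1 ℕ.+ k)
row-two-tails k X h = ℕ.≤-trans
  (ℕ.*-monoʳ-≤ (5 ℕ.+ k) {X} (ℕ.+-cancelʳ-≤ (6 ℕ.* k ℕ.+ 18) X
    (2 ℕ.* k ℕ.* k ℕ.+ 6 ℕ.* k)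
    (subst₂ _≤ℕ_ (lhs k X) (rhs k) h)))
  (slack-≤ {(5 ℕ.+ k) ℕ.* (2 ℕ.* k ℕ.* k ℕ.+ 6 ℕ.* k)} 16 (slack k))
  where
  lhs : ∀ k X → X ℕ.+ 2 ℕ.* (1 ℕ.+ k) ℕ.+ 2 ℕ.* (1 ℕ.+ k ℕ.+ (5 ℕ.+ k)) ℕ.+ 4 ≡
    X ℕ.+ (6 ℕ.* k ℕ.+ 18)
  lhs = solve-∀
  rhs : ∀ k → (3 ℕ.+ k) ℕ.* (1 ℕ.+ k) ℕ.+ (3 ℕ.+ k) ℕ.* (5 ℕ.+ k) ≡
    (2 ℕ.* k ℕ.* k ℕ.+ 6 ℕ.* k) ℕ.+ (6 ℕ.* k ℕ.+ 18)
  rhs = solve-∀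
  slack : ∀ k → (5 ℕ.+ k) ℕ.* (2 ℕ.* k ℕ.* k ℕ.+ 6 ℕ.* k) ℕ.+ 16 ≡
    (2 ℕ.* k ℕ.* k ℕ.+ 14 ℕ.* k ℕ.+ 16) ℕ.* (1 ℕ.+ k)
  slack = solve-∀

module TwoMissing {k} (D : Digraph (3 ℕ.+ k)) {u v u′ v′ : Fin (3 ℕ.+ k)}
  (uv : Missing D u v) (u′v′ : Missing D u′ v′) (distinct : ¬ (u ≡ u′ × v ≡ v′)) where

  n : ℕ
  n = 3 ℕ.+ k

  tails : Fin n → ℕ
  tails j = δ u j ℕ.+ δ u′ j

  weight : Fin n → ℕ
  weight j = 5 ℕ.+ k ℕ.∸ 2 ℕ.* tails j

  δ≤1 : ∀ (i j : Fin n) → δ i j ≤ℕ 1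
  δ≤1 i j with does (i Fin.≟ j)
  ... | true  = ℕ.≤-refl
  ... | false = ℕ.z≤n

  tails≤2 : ∀ j → tails j ≤ℕ 2
  tails≤2 j = ℕ.+-mono-≤ (δ≤1 u j) (δ≤1 u′ j)

  -- The least possible weight is n - 2, at a common tail of both arcs; it is positive because n ≥
  -- 3.
  1≤weight : ∀ j → 1 ≤ℕ weight j
  1≤weight j = ℕ.≤-trans (ℕ.m≤m+n 1 k) (ℕ.∸-monoʳ-≤ (5 ℕ.+ k) (ℕ.*-monoʳ-≤ 2 (tails≤2 j)))

  weight≤ : ∀ j → weight j ≤ℕ 5 ℕ.+ k
  weight≤ j = ℕ.m∸n≤m (5 ℕ.+ k) (2 ℕ.* tails j)

  weight+tails : ∀ j → weight j ℕ.+ 2 ℕ.* tails j ≡ 5 ℕ.+ k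
  weight+tails j = ℕ.m∸n+n≡m (ℕ.≤-trans (ℕ.*-monoʳ-≤ 2 (tails≤2 j)) (ℕ.m≤m+n 4 (suc k)))

  Σ-weight : Σℕ.sum weight ℕ.+ 4 ≡ n ℕ.* (5 ℕ.+ k)
  Σ-weight = begin
    Σℕ.sum weight ℕ.+ 4
      ≡⟨ cong (Σℕ.sum weight ℕ.+_) (sym Σ-tails) ⟩
    Σℕ.sum weight ℕ.+ Σℕ.sum (λ j → 2 ℕ.* tails j)
      ≡⟨ Σℕ.∑-distrib-+ weight (λ j → 2 ℕ.* tails j) ⟨
    Σℕ.sum (λ j → weight j ℕ.+ 2 ℕ.* tails j)
      ≡⟨ Σℕ.sum-cong-≗ weight+tails ⟩
    Σℕ.sum {n} (λ _ → 5 ℕ.+ k)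
      ≡⟨ Σℕ-const n (5 ℕ.+ k) ⟩
    n ℕ.* (5 ℕ.+ k) ∎
    where
    open ≡-Reasoning
    term : ∀ x y → 2 ℕ.* (x ℕ.+ y) ≡ x ℕ.* 2 ℕ.+ y ℕ.* 2
    term = solve-∀
    Σ-tails : Σℕ.sum (λ j → 2 ℕ.* tails j) ≡ 4
    Σ-tails = trans (Σℕ.sum-cong-≗ {n} (λ j → term (δ u j) (δ u′ j)))
      (trans (Σℕ.∑-distrib-+ (λ j → δ u j ℕ.* 2) (λ j → δ u′ j ℕ.* 2))
        (cong₂ ℕ._+_ (Σ-δ u (λ _ → 2)) (Σ-δ u′ (λ _ → 2))))

  hit : ∀ (u v i j : Fin n) →
    (u ≡ i × v ≡ j × δ u i ℕ.* δ v j ≡ 1) ⊎ δ u i ℕ.* δ v j ≡ 0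
  hit u v i j with u Fin.≟ i | v Fin.≟ j
  ... | yes p | yes q = inj₁ (p , q , refl)
  ... | yes _ | no  _ = inj₂ refl
  ... | no  _ | _     = inj₂ refl

  -- Arcs, diagonal and the two chosen missing arcs occupy disjoint positions. Any further missing
  -- arc leaves its position empty, hence no equality.
  at-most-one : ∀ i j → adjacency D i j ℕ.+ δ i j ℕ.+ δ u i ℕ.* δ v j ℕ.+ δ u′ i ℕ.* δ v′ j ≤ℕ 1
  at-most-one i j with hit u v i j | hit u′ v′ i j
  ... | inj₁ (refl , refl , _) | inj₁ (refl , refl , _) = contradiction (refl , refl) distinct
  ... | inj₁ (refl , refl , e) | inj₂ e′
    rewrite e | e′ | proj₂ uv | δ-≢ (proj₁ uv) = ℕ.≤-refl
  ... | inj₂ e | inj₁ (refl , refl , e′)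
    rewrite e | e′ | proj₂ u′v′ | δ-≢ (proj₁ u′v′) = ℕ.≤-refl
  ... | inj₂ e | inj₂ e′ rewrite e | e′ with i Fin.≟ j
  ...   | yes refl rewrite loopless D i = ℕ.≤-refl
  ...   | no _ with arc D i j
  ...     | true  = ℕ.≤-refl
  ...     | false = ℕ.z≤n

  -- The positions of row `i` are weighted by wᵢ + wⱼ and `at-most-one` is summed over j. What would
  -- be subtracted stands on the left instead, avoiding truncated subtraction; the 4 completes the
  -- total weight to n(n + 2).
  row-budget : ∀ i → Σℕ.sum (λ j → Q D i j ℕ.* weight j)
    ℕ.+ 2 ℕ.* weight i
    ℕ.+ (δ u i ℕ.* (weight i ℕ.+ weight v) ℕ.+ δ u′ i ℕ.* (weight i ℕ.+ weight v′)) ℕ.+ 4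
    ≤ℕ n ℕ.* weight i ℕ.+ n ℕ.* (5 ℕ.+ k)
  row-budget i = begin
    Σℕ.sum (λ j → Q D i j ℕ.* weight j) ℕ.+ 2 ℕ.* weight i ℕ.+ (a ℕ.* f v ℕ.+ b ℕ.* f v′) ℕ.+ 4
      ≡⟨ cong (λ x → x ℕ.+ 2 ℕ.* weight i ℕ.+ (a ℕ.* f v ℕ.+ b ℕ.* f v′) ℕ.+ 4)
           (Q-apply D weight i) ⟩
    Σℕ.sum (λ j → A j ℕ.* f j) ℕ.+ 2 ℕ.* weight i ℕ.+ (a ℕ.* f v ℕ.+ b ℕ.* f v′) ℕ.+ 4
      ≡⟨ cong (ℕ._+ 4) expand ⟨
    Σℕ.sum (λ j → (A j ℕ.+ δ i j ℕ.+ a ℕ.* δ v j ℕ.+ b ℕ.* δ v′ j) ℕ.* f j) ℕ.+ 4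
      ≤⟨ ℕ.+-monoˡ-≤ 4 (Σℕ-mono λ j → ℕ.*-monoˡ-≤ (f j) (at-most-one i j)) ⟩
    Σℕ.sum (λ j → 1 ℕ.* f j) ℕ.+ 4
      ≡⟨ cong (ℕ._+ 4) (Σℕ.sum-cong-≗ {n} (λ j → ℕ.*-identityˡ (f j))) ⟩
    Σℕ.sum f ℕ.+ 4
      ≡⟨ cong (ℕ._+ 4) (Σℕ.∑-distrib-+ (λ _ → weight i) weight) ⟩
    Σℕ.sum {n} (λ _ → weight i) ℕ.+ Σℕ.sum weight ℕ.+ 4
      ≡⟨ ℕ.+-assoc (Σℕ.sum {n} (λ _ → weight i)) (Σℕ.sum weight) 4 ⟩
    Σℕ.sum {n} (λ _ → weight i) ℕ.+ (Σℕ.sum weight ℕ.+ 4)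
      ≡⟨ cong₂ ℕ._+_ (Σℕ-const n (weight i)) Σ-weight ⟩
    n ℕ.* weight i ℕ.+ n ℕ.* (5 ℕ.+ k) ∎
    where
    open ℕ.≤-Reasoning
    A = adjacency D i
    a = δ u i
    b = δ u′ i
    f : Fin n → ℕ
    f j = weight i ℕ.+ weight j
    spread : ∀ A d a p b q f → (A ℕ.+ d ℕ.+ a ℕ.* p ℕ.+ b ℕ.* q) ℕ.* f ≡
      A ℕ.* f ℕ.+ d ℕ.* f ℕ.+ (p ℕ.* (a ℕ.* f) ℕ.+ q ℕ.* (b ℕ.* f))
    spread = solve-∀
    expand : Σℕ.sum (λ j → (A j ℕ.+ δ i j ℕ.+ a ℕ.* δ v j ℕ.+ b ℕ.* δ v′ j) ℕ.* f j) ≡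
      Σℕ.sum (λ j → A j ℕ.* f j) ℕ.+ 2 ℕ.* weight i ℕ.+ (a ℕ.* f v ℕ.+ b ℕ.* f v′)
    expand = begin-equality
      Σℕ.sum (λ j → (A j ℕ.+ δ i j ℕ.+ a ℕ.* δ v j ℕ.+ b ℕ.* δ v′ j) ℕ.* f j)
        ≡⟨ Σℕ.sum-cong-≗ {n} (λ j → spread (A j) (δ i j) a (δ v j) b (δ v′ j) (f j)) ⟩
      Σℕ.sum (λ j → s₁ j ℕ.+ s₂ j ℕ.+ (s₃ j ℕ.+ s₄ j))
        ≡⟨ Σℕ.∑-distrib-+ (λ j → s₁ j ℕ.+ s₂ j) (λ j → s₃ j ℕ.+ s₄ j) ⟩
      Σℕ.sum (λ j → s₁ j ℕ.+ s₂ j) ℕ.+ Σℕ.sum (λ j → s₃ j ℕ.+ s₄ j)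
        ≡⟨ cong₂ ℕ._+_ (Σℕ.∑-distrib-+ s₁ s₂) (Σℕ.∑-distrib-+ s₃ s₄) ⟩
      Σℕ.sum s₁ ℕ.+ Σℕ.sum s₂ ℕ.+ (Σℕ.sum s₃ ℕ.+ Σℕ.sum s₄)
        ≡⟨ cong₂ (λ x y → Σℕ.sum s₁ ℕ.+ x ℕ.+ y)
             (trans (Σ-δ i f) (cong (weight i ℕ.+_) (sym (ℕ.+-identityʳ (weight i)))))
             (cong₂ ℕ._+_ (Σ-δ v (λ j → a ℕ.* f j)) (Σ-δ v′ (λ j → b ℕ.* f j))) ⟩
      Σℕ.sum s₁ ℕ.+ 2 ℕ.* weight i ℕ.+ (a ℕ.* f v ℕ.+ b ℕ.* f v′) ∎
      where
      s₁ s₂ s₃ s₄ : Fin n → ℕ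
      s₁ j = A j ℕ.* f j
      s₂ j = δ i j ℕ.* f j
      s₃ j = δ v j ℕ.* (a ℕ.* f j)
      s₄ j = δ v′ j ℕ.* (b ℕ.* f j)

  weight-tails : ∀ {m} j → tails j ≡ m → weight j ≡ 5 ℕ.+ k ℕ.∸ 2 ℕ.* m
  weight-tails j refl = refl

  3+k≤weight : ∀ j → tails j ≤ℕ 1 → 3 ℕ.+ k ≤ℕ weight j
  3+k≤weight j h = ℕ.∸-monoʳ-≤ (5 ℕ.+ k) (ℕ.*-monoʳ-≤ 2 h)

  weighted-row : ∀ i → (5 ℕ.+ k) ℕ.* Σℕ.sum (λ j → Q D i j ℕ.* weight j) ≤ℕ
    (2 ℕ.* k ℕ.* k ℕ.+ 14 ℕ.* k ℕ.+ 16) ℕ.* weight i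
  weighted-row i = cases (u Fin.≟ i) (u′ Fin.≟ i) (row-budget i)
    where
    X = Σℕ.sum (λ j → Q D i j ℕ.* weight j)
    P = 2 ℕ.* k ℕ.* k ℕ.+ 14 ℕ.* k ℕ.+ 16
    Budget : ℕ → ℕ → ℕ → ℕ → ℕ → Set
    Budget w a b s s′ = X ℕ.+ 2 ℕ.* w ℕ.+ (a ℕ.* (w ℕ.+ s) ℕ.+ b ℕ.* (w ℕ.+ s′)) ℕ.+ 4
      ≤ℕ n ℕ.* w ℕ.+ n ℕ.* (5 ℕ.+ k)
    cases : Dec (u ≡ i) → Dec (u′ ≡ i) →
      Budget (weight i) (δ u i) (δ u′ i) (weight v) (weight v′) → (5 ℕ.+ k) ℕ.* X ≤ℕ P ℕ.* weight i
    cases (no u≢i) (no u′≢i) h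
      rewrite weight-tails i (cong₂ ℕ._+_ (δ-≢ u≢i) (δ-≢ u′≢i)) | δ-≢ u≢i | δ-≢ u′≢i =
      row-no-tail k X (subst (λ x → x ℕ.+ 4 ≤ℕ n ℕ.* (5 ℕ.+ k) ℕ.+ n ℕ.* (5 ℕ.+ k)) (ℕ.+-identityʳ _) h)
    cases (yes refl) (no u′≢i) h
      rewrite weight-tails u (cong₂ ℕ._+_ (δ-refl u) (δ-≢ u′≢i)) | δ-refl u | δ-≢ u′≢i =
      row-one-tail k X (weight v)
        -- The head `v` differs from `u`, so at most one of the two arcs has tail `v` and its weight
        -- is at least n.
        (3+k≤weight v (subst (_≤ℕ 1) (cong (ℕ._+ δ u′ v) (sym (δ-≢ (proj₁ uv)))) (δ≤1 u′ v)))
        (subst (λ x → X ℕ.+ 2 ℕ.* (3 ℕ.+ k) ℕ.+ x ℕ.+ 4 ≤ℕ n ℕ.* (3 ℕ.+ k) ℕ.+ n ℕ.* (5 ℕ.+ k))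
          (trans (ℕ.+-identityʳ _) (ℕ.*-identityˡ _)) h)
    cases (no u≢i) (yes refl) h
      rewrite weight-tails u′ (cong₂ ℕ._+_ (δ-≢ u≢i) (δ-refl u′)) | δ-≢ u≢i | δ-refl u′ =
      row-one-tail k X (weight v′)
        (3+k≤weight v′ (subst (_≤ℕ 1)
          (trans (sym (ℕ.+-identityʳ _)) (cong (δ u v′ ℕ.+_) (sym (δ-≢ (proj₁ u′v′))))) (δ≤1 u v′)))
        (subst (λ x → X ℕ.+ 2 ℕ.* (3 ℕ.+ k) ℕ.+ x ℕ.+ 4 ≤ℕ n ℕ.* (3 ℕ.+ k) ℕ.+ n ℕ.* (5 ℕ.+ k))
          (ℕ.*-identityˡ _) h)
    -- Both heads differ from the common tail, so they carry the full weight n + 2.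
    cases (yes refl) (yes refl) h
      rewrite weight-tails u (cong₂ ℕ._+_ (δ-refl u) (δ-refl u)) | δ-refl u
        | weight-tails v (cong₂ ℕ._+_ (δ-≢ (proj₁ uv)) (δ-≢ (proj₁ uv)))
        | weight-tails v′ (cong₂ ℕ._+_ (δ-≢ (proj₁ u′v′)) (δ-≢ (proj₁ u′v′))) =
      row-two-tails k X
        (subst (λ x → X ℕ.+ 2 ℕ.* (1 ℕ.+ k) ℕ.+ x ℕ.+ 4 ≤ℕ n ℕ.* (1 ℕ.+ k) ℕ.+ n ℕ.* (5 ℕ.+ k))
          (cong (ℕ._+ (1 ℕ.* (1 ℕ.+ k ℕ.+ (5 ℕ.+ k)))) (ℕ.*-identityˡ (1 ℕ.+ k ℕ.+ (5 ℕ.+ k)))) h)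

-- Order, sums and maxima of rationals.

module Σℚ = SemiringSum (CommutativeRing.semiring ℚ.+-*-commutativeRing)

≤-by-slack : ∀ {p q} s → 0ℚ ℚ.≤ s → q ≡ p ℚ.+ s → p ℚ.≤ q
≤-by-slack {p} s 0≤s refl =
  subst (ℚ._≤ p ℚ.+ s) (ℚ.+-identityʳ p) (ℚ.+-monoʳ-≤ p 0≤s)

0≤p+q : ∀ {p q} → 0ℚ ℚ.≤ p → 0ℚ ℚ.≤ q → 0ℚ ℚ.≤ p ℚ.+ q
0≤p+q = ℚ.+-mono-≤

0≤p*q : ∀ {p q} → 0ℚ ℚ.≤ p → 0ℚ ℚ.≤ q → 0ℚ ℚ.≤ p ℚ.* q
0≤p*q {p} {q} 0≤p 0≤q =
  subst (ℚ._≤ p ℚ.* q) (ℚ.*-zeroˡ 0ℚ) (*-mono-≤ ℚ.≤-refl 0≤q 0≤p 0≤q)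

0≤p² : ∀ p → 0ℚ ℚ.≤ p ℚ.* p
0≤p² p with ℚ.≤-total 0ℚ p
... | inj₁ 0≤p = 0≤p*q 0≤p 0≤p
... | inj₂ p≤0 = subst (0ℚ ℚ.≤_) (solve 1 (λ p → (:- p) :* (:- p) := p :* p) refl p)
  (0≤p*q 0≤-p 0≤-p)
  where
  0≤-p : 0ℚ ℚ.≤ ℚ.- p
  0≤-p = ℚ.neg-antimono-≤ p≤0

0≤q-p : ∀ {p q} → p ℚ.≤ q → 0ℚ ℚ.≤ q ℚ.- p
0≤q-p {p} {q} p≤q = subst (ℚ._≤ q ℚ.- p) (ℚ.+-inverseʳ p) (ℚ.+-monoˡ-≤ (ℚ.- p) p≤q)

*-cancel-≤ : ∀ r {p q} → 0ℚ ℚ.< r → r ℚ.* p ℚ.≤ r ℚ.* q → p ℚ.≤ q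
*-cancel-≤ r 0<r = ℚ.*-cancelˡ-≤-pos r {{ℚ.positive 0<r}}

½p<p : ∀ {p} → 0ℚ ℚ.< p → ½ ℚ.* p ℚ.< p
½p<p {p} 0<p = subst₂ ℚ._<_ (ℚ.+-identityˡ (½ ℚ.* p))
  (solve 1 (λ p → con ½ :* p :+ con ½ :* p := p) refl p)
  (ℚ.+-monoˡ-< (½ ℚ.* p) (0<½p 0<p))

-- The constant value of the sequence `fromℕ n`, so that `seq-bound` holds by `refl`.
ι : ℕ → ℚ
ι n = + n ℚ./ 1

0≤ι : ∀ n → 0ℚ ℚ.≤ ι n
0≤ι n = 0≤/ n 0

ι-+ : ∀ m n → ι (m ℕ.+ n) ≡ ι m ℚ.+ ι n
ι-+ zero    n = sym (ℚ.+-identityˡ (ι n))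
ι-+ (suc m) n = trans (suc-/ (m ℕ.+ n) 0) (trans (cong (ℚ._+ ι 1) (ι-+ m n))
  (trans (solve 3 (λ a b c → (a :+ b) :+ c := (a :+ c) :+ b) refl (ι m) (ι n) (ι 1))
    (cong (ℚ._+ ι n) (sym (suc-/ m 0)))))

ι-* : ∀ m n → ι (m ℕ.* n) ≡ ι m ℚ.* ι n
ι-* zero    n = sym (ℚ.*-zeroˡ (ι n))
ι-* (suc m) n = trans (ι-+ n (m ℕ.* n)) (trans (cong (ι n ℚ.+_) (ι-* m n))
  (trans (solve 2 (λ a b → b :+ a :* b := (a :+ con (ι 1)) :* b) refl (ι m) (ι n))
    (cong (ℚ._* ι n) (sym (suc-/ m 0)))))

ι-mono : ∀ {m n} → m ≤ℕ n → ι m ℚ.≤ ι n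
ι-mono {m} {n} m≤n = ≤-by-slack (ι (n ℕ.∸ m)) (0≤ι (n ℕ.∸ m))
  (trans (cong ι (sym (ℕ.m+[n∸m]≡n m≤n))) (ι-+ m (n ℕ.∸ m)))

0<ι : ∀ n → 0ℚ ℚ.< ι (suc n)
0<ι n = ℚ.<-≤-trans (ℚ.positive⁻¹ 1ℚ) (ι-mono (ℕ.s≤s (ℕ.z≤n {n})))

ι-Σ : ∀ {n} (f : Fin n → ℕ) → ι (Σℕ.sum f) ≡ Σℚ.sum (ι ∘ f)
ι-Σ {zero}  f = refl
ι-Σ {suc n} f = trans (ι-+ (f zero) (Σℕ.sum (f ∘ suc))) (cong (ι (f zero) ℚ.+_) (ι-Σ (f ∘ suc)))

Σℚ-mono : ∀ {n} {f g : Fin n → ℚ} → (∀ i → f i ℚ.≤ g i) → Σℚ.sum f ℚ.≤ Σℚ.sum g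
Σℚ-mono {zero}  f≤g = ℚ.≤-refl
Σℚ-mono {suc n} f≤g = ℚ.+-mono-≤ (f≤g zero) (Σℚ-mono (f≤g ∘ suc))

argmax : ∀ {n} → Fin n → (f : Fin n → ℚ) → ∃ λ i → ∀ j → f j ℚ.≤ f i
argmax {suc zero}    _ f = zero , λ { zero → ℚ.≤-refl }
argmax {suc (suc n)} _ f with argmax zero (f ∘ suc)
... | i , max with ℚ.≤-total (f zero) (f (suc i))
...   | inj₁ f₀≤ = suc i , λ { zero → f₀≤ ; (suc j) → max j }
...   | inj₂ ≤f₀ = zero , λ { zero → ℚ.≤-refl ; (suc j) → ℚ.≤-trans (max j) ≤f₀ }

-- Each point is compared linearly with the resulting vector (A, B). The weighted sum of these
-- comparisons is 2R(A² + B²) ≤ R(A² + B² + R²M), and R cancels: a triangle inequality without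
-- square roots.
weighted-sum-in-disc : ∀ {n} (p a b : Fin n → ℚ) {R M} →
  (∀ j → 0ℚ ℚ.≤ p j) → (∀ j → a j ℚ.* a j ℚ.+ b j ℚ.* b j ℚ.≤ M) → 0ℚ ℚ.≤ M →
  Σℚ.sum p ℚ.≤ R → 0ℚ ℚ.< R →
  let A = Σℚ.sum (λ j → p j ℚ.* a j) ; B = Σℚ.sum (λ j → p j ℚ.* b j)
  in A ℚ.* A ℚ.+ B ℚ.* B ℚ.≤ (R ℚ.* R) ℚ.* M
weighted-sum-in-disc {n} p a b {R} {M} 0≤p disc 0≤M Σp≤R 0<R =
  *-cancel-≤ R 0<R (subst₂ ℚ._≤_
    (solve 3 (λ r a b → (r :+ r) :* (a :* a :+ b :* b) :- r :* (a :* a :+ b :* b)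
       := r :* (a :* a :+ b :* b)) refl R A B)
    (solve 4 (λ r a b m → r :* (a :* a :+ b :* b :+ (r :* r) :* m) :- r :* (a :* a :+ b :* b)
       := r :* ((r :* r) :* m)) refl R A B M)
    (ℚ.+-monoˡ-≤ (ℚ.- (R ℚ.* (A ℚ.* A ℚ.+ B ℚ.* B))) summed))
  where
  A = Σℚ.sum (λ j → p j ℚ.* a j)
  B = Σℚ.sum (λ j → p j ℚ.* b j)
  T = A ℚ.* A ℚ.+ B ℚ.* B ℚ.+ (R ℚ.* R) ℚ.* M
  0≤T : 0ℚ ℚ.≤ T
  0≤T = 0≤p+q (0≤p+q (0≤p² A) (0≤p² B)) (0≤p*q (0≤p² R) 0≤M)
  -- T − 2R(aA + bB) = (A − Ra)² + (B − Rb)² + R²(M − a² − b²)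
  term : ∀ j → (R ℚ.+ R) ℚ.* (a j ℚ.* A ℚ.+ b j ℚ.* B) ℚ.≤ T
  term j = ≤-by-slack _
    (0≤p+q (0≤p+q (0≤p² (A ℚ.- R ℚ.* a j)) (0≤p² (B ℚ.- R ℚ.* b j)))
      (0≤p*q (0≤p² R) (0≤q-p (disc j))))
    (solve 6 (λ r m A B x y → A :* A :+ B :* B :+ (r :* r) :* m :=
      (r :+ r) :* (x :* A :+ y :* B) :+
      ((A :- r :* x) :* (A :- r :* x) :+ (B :- r :* y) :* (B :- r :* y)
        :+ (r :* r) :* (m :- (x :* x :+ y :* y))))
      refl R M A B (a j) (b j))
  summed : (R ℚ.+ R) ℚ.* (A ℚ.* A ℚ.+ B ℚ.* B) ℚ.≤ R ℚ.* T
  summed = begin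
    (R ℚ.+ R) ℚ.* (A ℚ.* A ℚ.+ B ℚ.* B)
      ≡⟨ solve 3 (λ r a b → (r :+ r) :* (a :* a :+ b :* b) :=
           ((r :+ r) :* a) :* a :+ ((r :+ r) :* b) :* b) refl R A B ⟩
    ((R ℚ.+ R) ℚ.* A) ℚ.* A ℚ.+ ((R ℚ.+ R) ℚ.* B) ℚ.* B
      ≡⟨ cong₂ ℚ._+_
           (Σℚ.*-distribˡ-sum ((R ℚ.+ R) ℚ.* A) (λ j → p j ℚ.* a j))
           (Σℚ.*-distribˡ-sum ((R ℚ.+ R) ℚ.* B) (λ j → p j ℚ.* b j)) ⟩
    Σℚ.sum (λ j → ((R ℚ.+ R) ℚ.* A) ℚ.* (p j ℚ.* a j)) ℚ.+
    Σℚ.sum (λ j → ((R ℚ.+ R) ℚ.* B) ℚ.* (p j ℚ.* b j))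
      ≡⟨ Σℚ.∑-distrib-+ (λ j → ((R ℚ.+ R) ℚ.* A) ℚ.* (p j ℚ.* a j))
           (λ j → ((R ℚ.+ R) ℚ.* B) ℚ.* (p j ℚ.* b j)) ⟨
    Σℚ.sum (λ j → ((R ℚ.+ R) ℚ.* A) ℚ.* (p j ℚ.* a j) ℚ.+ ((R ℚ.+ R) ℚ.* B) ℚ.* (p j ℚ.* b j))
      ≡⟨ Σℚ.sum-cong-≗ {n} (λ j → solve 6 (λ r A B p x y →
           ((r :+ r) :* A) :* (p :* x) :+ ((r :+ r) :* B) :* (p :* y) :=
           p :* ((r :+ r) :* (x :* A :+ y :* B))) refl R A B (p j) (a j) (b j)) ⟩
    Σℚ.sum (λ j → p j ℚ.* ((R ℚ.+ R) ℚ.* (a j ℚ.* A ℚ.+ b j ℚ.* B)))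
      ≤⟨ Σℚ-mono (λ j → ℚ.*-monoˡ-≤-nonNeg (p j) {{ℚ.nonNegative (0≤p j)}} (term j)) ⟩
    Σℚ.sum (λ j → p j ℚ.* T)
      ≡⟨ Σℚ.*-distribʳ-sum T p ⟨
    Σℚ.sum p ℚ.* T
      ≤⟨ ℚ.*-monoʳ-≤-nonNeg T {{ℚ.nonNegative 0≤T}} Σp≤R ⟩
    R ℚ.* T ∎
    where open ℚ.≤-Reasoning

-- From Cauchy sequences to their rational terms.

eventually-all : ∀ {n} {P : Fin n → ℕ → Set} →
  (∀ i → ∃ λ N → ∀ m → N ≤ℕ m → P i m) → ∃ λ N → ∀ m → N ≤ℕ m → ∀ i → P i m
eventually-all {zero}  _ = 0 , λ _ _ ()
eventually-all {suc n} h with h zero | eventually-all (h ∘ suc)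
... | M , h₀ | N , hₛ = M ℕ.⊔ N , λ where
  m m≥ zero    → h₀ m (ℕ.m⊔n≤o⇒m≤o M N m≥)
  m m≥ (suc i) → hₛ m (ℕ.m⊔n≤o⇒n≤o M N m≥) i

-- Squaring is uniformly continuous only on bounded sets, hence the eventual bounds `A` and `B`.
≈⇒square-≤ : ∀ {x y} → x ≈ y → ∀ ε → 0ℚ ℚ.< ε →
  ∃ λ N → ∀ m → N ≤ℕ m → seq y m ℚ.* seq y m ℚ.< seq x m ℚ.* seq x m ℚ.+ ε
≈⇒square-≤ {x} {y} x≈y ε 0<ε =
  let A , 0<A , M₁ , bx = eventually-bounded {seq x} (isCauchy x)
      B , 0<B , M₂ , by = eventually-bounded {seq y} (isCauchy y)
      δ , 0<δ , eq = split ε A B 0<ε 0<A 0<B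
      N , close = x≈y δ 0<δ
  in (M₁ ℕ.⊔ M₂) ℕ.⊔ N , λ m m≥ →
  let m≥⊔ = ℕ.m⊔n≤o⇒m≤o (M₁ ℕ.⊔ M₂) N m≥
      xy  = close m (ℕ.m⊔n≤o⇒n≤o (M₁ ℕ.⊔ M₂) N m≥)
      X   = seq x m
      Y   = seq y m
  in ∣p-q∣<r⇒p<q+r (Y ℚ.* Y) (X ℚ.* X) ε (subst₂ ℚ._<_ (∣p-q∣≡∣q-p∣ (X ℚ.* X) (Y ℚ.* Y)) eq
       (∣pr-qs∣< X Y X Y 0<A 0<B (bx m (ℕ.m⊔n≤o⇒m≤o M₁ M₂ m≥⊔))
         (by m (ℕ.m⊔n≤o⇒n≤o M₁ M₂ m≥⊔)) xy xy))

norm² : ℚ → ℚ → ℚ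
norm² a b = a ℚ.* a ℚ.+ b ℚ.* b

0≤norm² : ∀ a b → 0ℚ ℚ.≤ norm² a b
0≤norm² a b = 0≤p+q (0≤p² a) (0≤p² b)

p²<q²⇒∣p-0∣<q : ∀ p {q} → 0ℚ ℚ.≤ q → p ℚ.* p ℚ.< q ℚ.* q → ℚ.∣ p ℚ.- 0ℚ ∣ ℚ.< q
p²<q²⇒∣p-0∣<q p {q} 0≤q h = subst (λ x → ℚ.∣ x ∣ ℚ.< q) (sym (ℚ.+-identityʳ p))
  (square-cancel-< 0≤q (subst (ℚ._< q ℚ.* q)
    (trans (sym (ℚ.0≤p⇒∣p∣≡p (0≤p² p))) (ℚ.∣p*q∣≡∣p∣*∣q∣ p p)) h))

seq-re-Σ : ∀ {n} (t : Fin n → ℂ) m →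
  seq (re (Sum.sum +ℂ-rawMonoid t)) m ≡ Σℚ.sum (λ j → seq (re (t j)) m)
seq-re-Σ {zero}  t m = refl
seq-re-Σ {suc n} t m = cong (seq (re (t zero)) m ℚ.+_) (seq-re-Σ (t ∘ suc) m)

seq-im-Σ : ∀ {n} (t : Fin n → ℂ) m →
  seq (im (Sum.sum +ℂ-rawMonoid t)) m ≡ Σℚ.sum (λ j → seq (im (t j)) m)
seq-im-Σ {zero}  t m = refl
seq-im-Σ {suc n} t m = cong (seq (im (t zero)) m ℚ.+_) (seq-im-Σ (t ∘ suc) m)

seq-re-*ℂ : ∀ z w m → seq (re (z *ℂ w)) m ≡
  seq (re z) m ℚ.* seq (re w) m ℚ.- seq (im z) m ℚ.* seq (im w) m
seq-re-*ℂ z w m = refl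

seq-im-*ℂ : ∀ z w m → seq (im (z *ℂ w)) m ≡
  seq (re z) m ℚ.* seq (im w) m ℚ.+ seq (im z) m ℚ.* seq (re w) m
seq-im-*ℂ z w m = refl

-- Multiplicativity of the modulus, |z|²|x|² = |zx|², with an error `δ` for each of the real and
-- imaginary parts.
product-norm² : ∀ c d a b {e f A B A′ B′ δ} →
  e ≡ c ℚ.* a ℚ.- d ℚ.* b → f ≡ c ℚ.* b ℚ.+ d ℚ.* a → A ≡ A′ → B ≡ B′ →
  e ℚ.* e ℚ.< A ℚ.* A ℚ.+ δ → f ℚ.* f ℚ.< B ℚ.* B ℚ.+ δ →
  norm² c d ℚ.* norm² a b ℚ.≤ norm² A′ B′ ℚ.+ (δ ℚ.+ δ)
product-norm² c d a b {A = A} {B} {δ = δ} refl refl refl refl h₁ h₂ = begin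
  (c ℚ.* c ℚ.+ d ℚ.* d) ℚ.* (a ℚ.* a ℚ.+ b ℚ.* b)
    ≡⟨ solve 4 (λ c d a b → (c :* c :+ d :* d) :* (a :* a :+ b :* b) :=
         (c :* a :- d :* b) :* (c :* a :- d :* b) :+ (c :* b :+ d :* a) :* (c :* b :+ d :* a))
         refl c d a b ⟩
  (c ℚ.* a ℚ.- d ℚ.* b) ℚ.* (c ℚ.* a ℚ.- d ℚ.* b) ℚ.+
  (c ℚ.* b ℚ.+ d ℚ.* a) ℚ.* (c ℚ.* b ℚ.+ d ℚ.* a)
    ≤⟨ ℚ.+-mono-≤ (ℚ.<⇒≤ h₁) (ℚ.<⇒≤ h₂) ⟩
  (A ℚ.* A ℚ.+ δ) ℚ.+ (B ℚ.* B ℚ.+ δ)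
    ≡⟨ solve 3 (λ A B d → (A :+ d) :+ (B :+ d) := (A :+ B) :+ (d :+ d)) refl
         (A ℚ.* A) (B ℚ.* B) δ ⟩
  (A ℚ.* A ℚ.+ B ℚ.* B) ℚ.+ (δ ℚ.+ δ) ∎
  where open ℚ.≤-Reasoning

-- Read Z = |z|², ν = |xᵢ|² at the dominant index, A = |(Mx)ᵢ|² and ν′ = |xⱼ|². Then (R + ε)ν ≤ Zν ≤
-- Rν + δ leaves εν ≤ δ, and ν′ is at most K times ν.
far-norm-small : ∀ {R K Z ν ν′ ε A δ} → 0ℚ ℚ.≤ K → 0ℚ ℚ.< ε → 0ℚ ℚ.≤ ν →
  R ℚ.+ ε ℚ.≤ Z → Z ℚ.* ν ℚ.≤ A ℚ.+ δ → A ℚ.≤ R ℚ.* ν → ν′ ℚ.≤ K ℚ.* ν →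
  ε ℚ.* ν′ ℚ.≤ K ℚ.* δ
far-norm-small {R} {K} {Z} {ν} {ν′} {ε} {A} {δ} 0≤K 0<ε 0≤ν far Zν≤ A≤ ν′≤ = begin
  ε ℚ.* ν′
    ≤⟨ ℚ.*-monoˡ-≤-nonNeg ε {{ℚ.nonNegative (ℚ.<⇒≤ 0<ε)}} ν′≤ ⟩
  ε ℚ.* (K ℚ.* ν)
    ≡⟨ solve 3 (λ e v n → e :* (v :* n) := v :* (e :* n)) refl ε K ν ⟩
  K ℚ.* (ε ℚ.* ν)
    ≤⟨ ℚ.*-monoˡ-≤-nonNeg K {{ℚ.nonNegative 0≤K}} εν≤δ ⟩
  K ℚ.* δ ∎
  where
  open ℚ.≤-Reasoning
  εν≤δ : ε ℚ.* ν ℚ.≤ δ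
  εν≤δ = subst₂ ℚ._≤_
    (solve 3 (λ r e v → (r :+ e) :* v :- r :* v := e :* v) refl R ε ν)
    (solve 2 (λ a d → a :+ d :- a := d) refl (R ℚ.* ν) δ)
    (ℚ.+-monoˡ-≤ (ℚ.- (R ℚ.* ν)) (ℚ.≤-trans
      (ℚ.*-monoʳ-≤-nonNeg ν {{ℚ.nonNegative 0≤ν}} far)
      (ℚ.≤-trans Zν≤ (ℚ.+-monoˡ-≤ δ A≤))))

norm²<⇒∣re∣< : ∀ a b η → 0ℚ ℚ.< η → norm² a b ℚ.< η ℚ.* η → ℚ.∣ a ℚ.- 0ℚ ∣ ℚ.< η
norm²<⇒∣re∣< a b η 0<η h = p²<q²⇒∣p-0∣<q a (ℚ.<⇒≤ 0<η)
  (ℚ.≤-<-trans (≤-by-slack (b ℚ.* b) (0≤p² b) refl) h)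

norm²<⇒∣im∣< : ∀ a b η → 0ℚ ℚ.< η → norm² a b ℚ.< η ℚ.* η → ℚ.∣ b ℚ.- 0ℚ ∣ ℚ.< η
norm²<⇒∣im∣< a b η 0<η h = norm²<⇒∣re∣< b a η 0<η
  (subst (ℚ._< η ℚ.* η) (ℚ.+-comm (a ℚ.* a) (b ℚ.* b)) h)

-- One late rational term decides: terms beyond `N` differ by less than ε/4, so a term `N` below r +
-- ε/2 keeps all later ones below r + ε, and otherwise they all stay above r + ε/4.
≤-fromℚ : ∀ x r →
  ¬ (∃ λ g → 0ℚ ℚ.< g × (∃ λ N → ∀ m → N ≤ℕ m → r ℚ.+ g ℚ.≤ seq x m)) → x ≤ fromℚ r
≤-fromℚ x r ¬above ε 0<ε with isCauchy x (½ ℚ.* (½ ℚ.* ε)) (0<½p (0<½p 0<ε))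
... | N , cauchy with seq x N ℚ.<? (r ℚ.+ (½ ℚ.* ε))
...   | yes near = N , λ m m≥ → ℚ.<-≤-trans
  (∣p-q∣<r⇒p<q+r (seq x m) (seq x N) (½ ℚ.* (½ ℚ.* ε)) (cauchy m N m≥ ℕ.≤-refl))
  (ℚ.<⇒≤ (ℚ.<-≤-trans (ℚ.+-monoˡ-< (½ ℚ.* (½ ℚ.* ε)) near)
    (≤-by-slack (½ ℚ.* (½ ℚ.* ε)) (ℚ.<⇒≤ (0<½p (0<½p 0<ε)))
      (solve 2 (λ r e → r :+ e := r :+ con ½ :* e :+ con ½ :* (con ½ :* e) :+ con ½ :* (con ½ :* e))
        refl r ε))))
...   | no far = contradiction (½ ℚ.* (½ ℚ.* ε) , 0<½p (0<½p 0<ε) , N , above) ¬above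
  where
  above : ∀ m → N ≤ℕ m → r ℚ.+ ½ ℚ.* (½ ℚ.* ε) ℚ.≤ seq x m
  above m m≥ = subst₂ ℚ._≤_
    (solve 2 (λ r e → r :+ con ½ :* e :- con ½ :* (con ½ :* e) := r :+ con ½ :* (con ½ :* e))
      refl r ε)
    (solve 2 (λ a g → a :+ g :- g := a) refl (seq x m) (½ ℚ.* (½ ℚ.* ε)))
    (ℚ.+-monoˡ-≤ (ℚ.- (½ ℚ.* (½ ℚ.* ε))) (ℚ.≤-trans (ℚ.≮⇒≥ far)
      (ℚ.<⇒≤ (∣p-q∣<r⇒p<q+r (seq x N) (seq x m) (½ ℚ.* (½ ℚ.* ε)) (cauchy N m ℕ.≤-refl m≥)))))

-- `rationalRoot` rounds down, so a lower bound on it may be squared. The cross term 2rg is dropped;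
-- g² is gap enough.
rationalRoot-norm² : ∀ m c d {r g} → 0ℚ ℚ.≤ r → 0ℚ ℚ.< g →
  r ℚ.+ g ℚ.≤ rationalRoot m (c ℚ.* c ℚ.+ d ℚ.* d) → r ℚ.* r ℚ.+ g ℚ.* g ℚ.≤ norm² c d
rationalRoot-norm² m c d {r} {g} 0≤r 0<g r+g≤ = begin
  r ℚ.* r ℚ.+ g ℚ.* g
    ≤⟨ ≤-by-slack (r ℚ.* g ℚ.+ r ℚ.* g) (0≤p+q 0≤rg 0≤rg)
         (solve 2 (λ r g → (r :+ g) :* (r :+ g) := r :* r :+ g :* g :+ (r :* g :+ r :* g))
           refl r g) ⟩
  (r ℚ.+ g) ℚ.* (r ℚ.+ g)
    ≤⟨ *-mono-≤ 0≤r+g (ℚ.≤-trans 0≤r+g r+g≤) r+g≤ r+g≤ ⟩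
  rationalRoot m (norm² c d) ℚ.* rationalRoot m (norm² c d)
    ≤⟨ rationalRoot-lower m (norm² c d) ⟩
  norm² c d ℚ.⊔ 0ℚ
    ≡⟨ ℚ.p≥q⇒p⊔q≡p (0≤norm² c d) ⟩
  norm² c d ∎
  where
  open ℚ.≤-Reasoning
  0≤rg : 0ℚ ℚ.≤ r ℚ.* g
  0≤rg = 0≤p*q 0≤r (ℚ.<⇒≤ 0<g)
  0≤r+g : 0ℚ ℚ.≤ r ℚ.+ g
  0≤r+g = 0≤p+q 0≤r (ℚ.<⇒≤ 0<g)

-- The Collatz-Wielandt bound for eigenvalues of a nonnegative matrix.

module CollatzWielandt {n} (W : Matrix ℕ n) (w : Fin n → ℚ) (r V : ℚ) (0<r : 0ℚ ℚ.< r)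
  (1≤w : ∀ i → 1ℚ ℚ.≤ w i) (w≤V : ∀ i → w i ℚ.≤ V)
  (row : ∀ i → Σℚ.sum (λ j → ι (W i j) ℚ.* w j) ℚ.≤ r ℚ.* w i) where

  0≤r : 0ℚ ℚ.≤ r
  0≤r = ℚ.<⇒≤ 0<r

  0<w : ∀ i → 0ℚ ℚ.< w i
  0<w i = ℚ.<-≤-trans (ℚ.positive⁻¹ 1ℚ) (1≤w i)

  apply : (Fin n → ℚ) → Fin n → ℚ
  apply x i = Σℚ.sum (λ j → ι (W i j) ℚ.* x j)

  -- i is an index at which the modulus of x + √−1 y, divided by w, is greatest
  dominant-row : Fin n → ∀ x y → ∃ λ i →
    (∀ j → norm² (x j) (y j) ℚ.≤ (V ℚ.* V) ℚ.* norm² (x i) (y i)) ×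
    norm² (apply x i) (apply y i) ℚ.≤ (r ℚ.* r) ℚ.* norm² (x i) (y i)
  dominant-row j₀ x y = i , bounded , contracted
    where
    inv : Fin n → ℚ
    inv j = proj₁ (divide 1ℚ (w j) (ℚ.positive⁻¹ 1ℚ) (0<w j))
    w*inv : ∀ j → w j ℚ.* inv j ≡ 1ℚ
    w*inv j = proj₂ (proj₂ (divide 1ℚ (w j) (ℚ.positive⁻¹ 1ℚ) (0<w j)))
    a b Y : Fin n → ℚ
    a j = x j ℚ.* inv j
    b j = y j ℚ.* inv j
    Y j = norm² (a j) (b j)
    i = proj₁ (argmax j₀ Y)
    max = proj₂ (argmax j₀ Y)
    w²*Y : ∀ j → (w j ℚ.* w j) ℚ.* Y j ≡ norm² (x j) (y j)
    w²*Y j = trans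
      (solve 4 (λ w c x y →
        (w :* w) :* ((x :* c) :* (x :* c) :+ (y :* c) :* (y :* c)) :=
        (w :* c) :* (w :* c) :* (x :* x :+ y :* y)) refl (w j) (inv j) (x j) (y j))
      (trans (cong (λ e → e ℚ.* e ℚ.* norm² (x j) (y j)) (w*inv j)) (ℚ.*-identityˡ (norm² (x j) (y j))))
    0≤w : ∀ j → 0ℚ ℚ.≤ w j
    0≤w j = ℚ.<⇒≤ (0<w j)
    bounded : ∀ j → norm² (x j) (y j) ℚ.≤ (V ℚ.* V) ℚ.* norm² (x i) (y i)
    bounded j = begin
      norm² (x j) (y j)                  ≡⟨ w²*Y j ⟨
      (w j ℚ.* w j) ℚ.* Y j        ≤⟨ *-mono-≤ (0≤p² (w j)) (0≤norm² (a i) (b i))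
                                        (*-mono-≤ (0≤w j) 0≤V (w≤V j) (w≤V j)) (max j) ⟩
      (V ℚ.* V) ℚ.* Y i            ≤⟨ ℚ.*-monoˡ-≤-nonNeg (V ℚ.* V) {{ℚ.nonNegative (0≤p² V)}} Yi≤ ⟩
      (V ℚ.* V) ℚ.* norm² (x i) (y i)    ∎
      where
      open ℚ.≤-Reasoning
      0≤V : 0ℚ ℚ.≤ V
      0≤V = ℚ.≤-trans (0≤w j) (w≤V j)
      -- `1≤w` turns a bound by |xᵢ|²/wᵢ² into one by |xᵢ|².
      1≤w² : 1ℚ ℚ.≤ w i ℚ.* w i
      1≤w² = *-mono-≤ (ℚ.nonNegative⁻¹ 1ℚ) (0≤w i) (1≤w i) (1≤w i)
      Yi≤ : Y i ℚ.≤ norm² (x i) (y i)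
      Yi≤ = subst₂ ℚ._≤_ (ℚ.*-identityˡ (Y i)) (w²*Y i)
        (ℚ.*-monoʳ-≤-nonNeg (Y i) {{ℚ.nonNegative (0≤norm² (a i) (b i))}} 1≤w²)
    -- The coefficients of row `i` after substituting x = w a; their sum is at most r wᵢ.
    p : Fin n → ℚ
    p j = ι (W i j) ℚ.* w j
    p*a : ∀ (f : Fin n → ℚ) j → p j ℚ.* (f j ℚ.* inv j) ≡ ι (W i j) ℚ.* f j
    p*a f j = trans
      (solve 4 (λ q w f c → (q :* w) :* (f :* c) := (w :* c) :* (q :* f)) refl
        (ι (W i j)) (w j) (f j) (inv j))
      (trans (cong (ℚ._* (ι (W i j) ℚ.* f j)) (w*inv j)) (ℚ.*-identityˡ (ι (W i j) ℚ.* f j)))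
    contracted : norm² (apply x i) (apply y i) ℚ.≤ (r ℚ.* r) ℚ.* norm² (x i) (y i)
    contracted = subst₂ ℚ._≤_
      (cong₂ (λ A B → A ℚ.* A ℚ.+ B ℚ.* B)
        (Σℚ.sum-cong-≗ {n} (p*a x)) (Σℚ.sum-cong-≗ {n} (p*a y)))
      (trans (solve 3 (λ r w y → ((r :* w) :* (r :* w)) :* y := (r :* r) :* ((w :* w) :* y))
          refl r (w i) (Y i))
        (cong ((r ℚ.* r) ℚ.*_) (w²*Y i)))
      (weighted-sum-in-disc p a b (λ j → 0≤p*q (0≤ι (W i j)) (0≤w j)) max (0≤norm² (a i) (b i))
        (row i) (0<p*q 0<r (0<w i)))

  M : Matrix ℂ n
  M i j = ℕ→ℂ (W i j)

  seq-re-M : ∀ x i m → seq (re ((M · x) i)) m ≡ apply (λ j → seq (re (x j)) m) i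
  seq-re-M x i m = trans (seq-re-Σ (λ j → M i j *ℂ x j) m) (Σℚ.sum-cong-≗ {n} λ j →
    solve 3 (λ k a b → k :* a :+ (:- (con 0ℚ :* b)) := k :* a) refl
      (ι (W i j)) (seq (re (x j)) m) (seq (im (x j)) m))

  seq-im-M : ∀ x i m → seq (im ((M · x) i)) m ≡ apply (λ j → seq (im (x j)) m) i
  seq-im-M x i m = trans (seq-im-Σ (λ j → M i j *ℂ x j) m) (Σℚ.sum-cong-≗ {n} λ j →
    solve 3 (λ k a b → k :* b :+ con 0ℚ :* a := k :* b) refl
      (ι (W i j)) (seq (re (x j)) m) (seq (im (x j)) m))

  Eventually : (ℕ → Set) → Set
  Eventually P = ∃ λ N → ∀ m → N ≤ℕ m → P m

  -- One threshold serves all rows, because the dominant row varies with the term `m`.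
  eigenvector-square : ∀ z x → (∀ i → (M · x) i ≈ℂ z *ℂ x i) → ∀ δ → 0ℚ ℚ.< δ →
    Eventually λ m → ∀ i →
      norm² (seq (re z) m) (seq (im z) m) ℚ.* norm² (seq (re (x i)) m) (seq (im (x i)) m) ℚ.≤
      norm² (apply (λ j → seq (re (x j)) m) i) (apply (λ j → seq (im (x j)) m) i) ℚ.+ (δ ℚ.+ δ)
  eigenvector-square z x Mx≈zx δ 0<δ = eventually-all close
    where
    close : ∀ i → Eventually λ m →
      norm² (seq (re z) m) (seq (im z) m) ℚ.* norm² (seq (re (x i)) m) (seq (im (x i)) m) ℚ.≤
      norm² (apply (λ j → seq (re (x j)) m) i) (apply (λ j → seq (im (x j)) m) i) ℚ.+ (δ ℚ.+ δ)
    close i =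
      let N₁ , h₁ = ≈⇒square-≤ {re ((M · x) i)} {re (z *ℂ x i)} (proj₁ (Mx≈zx i)) δ 0<δ
          N₂ , h₂ = ≈⇒square-≤ {im ((M · x) i)} {im (z *ℂ x i)} (proj₂ (Mx≈zx i)) δ 0<δ
      in N₁ ℕ.⊔ N₂ , λ m m≥ →
      product-norm² (seq (re z) m) (seq (im z) m) (seq (re (x i)) m) (seq (im (x i)) m)
        (seq-re-*ℂ z (x i) m) (seq-im-*ℂ z (x i) m) (seq-re-M x i m) (seq-im-M x i m)
        (h₁ m (ℕ.m⊔n≤o⇒m≤o N₁ N₂ m≥)) (h₂ m (ℕ.m⊔n≤o⇒n≤o N₁ N₂ m≥))

  -- At each late term the dominant row gives ε|xᵢ|² ≤ 2δ, and every other squared entry is at most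
  -- V² times that one. Neither constant depends on the term, so the dominant index may jump.
  eigenvector-vanishes : ∀ z x → (∀ i → (M · x) i ≈ℂ z *ℂ x i) → ∀ ε → 0ℚ ℚ.< ε →
    Eventually (λ m → r ℚ.* r ℚ.+ ε ℚ.≤ norm² (seq (re z) m) (seq (im z) m)) →
    ∀ i → x i ≈ℂ ℕ→ℂ 0
  eigenvector-vanishes z x Mx≈zx ε 0<ε (N₀ , far) j =
    (λ η 0<η → let N , h = small (η ℚ.* η) (0<p*q 0<η 0<η) in
      N , λ m m≥ → norm²<⇒∣re∣< (seq (re (x j)) m) (seq (im (x j)) m) η 0<η (h m m≥)) ,
    (λ η 0<η → let N , h = small (η ℚ.* η) (0<p*q 0<η 0<η) in
      N , λ m m≥ → norm²<⇒∣im∣< (seq (re (x j)) m) (seq (im (x j)) m) η 0<η (h m m≥))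
    where
    0<V : 0ℚ ℚ.< V
    0<V = ℚ.<-≤-trans (0<w j) (w≤V j)

    decay : ∀ δ → 0ℚ ℚ.< δ → Eventually λ m →
      ε ℚ.* norm² (seq (re (x j)) m) (seq (im (x j)) m) ℚ.≤ (V ℚ.* V) ℚ.* (δ ℚ.+ δ)
    decay δ 0<δ =
      let N₁ , close = eigenvector-square z x Mx≈zx δ 0<δ
      in N₀ ℕ.⊔ N₁ , λ m m≥ →
      let i , bounded , contracted =
            dominant-row j (λ i → seq (re (x i)) m) (λ i → seq (im (x i)) m)
      in far-norm-small {R = r ℚ.* r} (0≤p² V) 0<ε (0≤norm² (seq (re (x i)) m) (seq (im (x i)) m))
           (far m (ℕ.m⊔n≤o⇒m≤o N₀ N₁ m≥)) (close m (ℕ.m⊔n≤o⇒n≤o N₀ N₁ m≥) i)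
           contracted (bounded j)

    small : ∀ η → 0ℚ ℚ.< η → Eventually λ m → norm² (seq (re (x j)) m) (seq (im (x j)) m) ℚ.< η
    small η 0<η =
      -- Chosen so that 2δV² = εη/2.
      let δ , 0<δ , eq = split (ε ℚ.* (½ ℚ.* η)) (V ℚ.* V) (V ℚ.* V) (0<p*q 0<ε (0<½p 0<η))
            (0<p*q 0<V 0<V) (0<p*q 0<V 0<V)
          N , h = decay δ 0<δ
      in N , λ m m≥ → ℚ.≤-<-trans
        (*-cancel-≤ ε 0<ε (subst (ε ℚ.* norm² (seq (re (x j)) m) (seq (im (x j)) m) ℚ.≤_)
          (trans (solve 2 (λ v d → v :* (d :+ d) := v :* d :+ d :* v) refl (V ℚ.* V) δ) eq)
          (h m m≥)))
        (½p<p 0<η)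

  eigenvalue-bound : ∀ z → IsEigenvalue M z → modulus z ≤ fromℚ r
  eigenvalue-bound z (x , x≉0 , Mx≈zx) = ≤-fromℚ (modulus z) r λ (g , 0<g , N , h) →
    x≉0 (eigenvector-vanishes z x Mx≈zx (g ℚ.* g) (0<p*q 0<g 0<g)
      (N , λ m m≥ → rationalRoot-norm² m (seq (re z) m) (seq (im z) m) 0≤r 0<g (h m m≥)))

-- The gap between r and the bound.

≈-≤-eventually : ∀ {x y r} → x ≈ y → x ≤ fromℚ r → ∀ ε → 0ℚ ℚ.< ε →
  ∃ λ N → ∀ m → N ≤ℕ m → seq y m ℚ.< r ℚ.+ ε
≈-≤-eventually {x} {y} {r} x≈y x≤r ε 0<ε =
  let M , h₁ = x≈y (½ ℚ.* ε) (0<½p 0<ε)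
      N , h₂ = x≤r (½ ℚ.* ε) (0<½p 0<ε)
  in M ℕ.⊔ N , λ m m≥ → subst (seq y m ℚ.<_)
    (solve 2 (λ r e → r :+ con ½ :* e :+ con ½ :* e := r :+ e) refl r ε)
    (ℚ.<-trans
      (∣p-q∣<r⇒p<q+r (seq y m) (seq x m) (½ ℚ.* ε)
        (subst (ℚ._< ½ ℚ.* ε) (∣p-q∣≡∣q-p∣ (seq x m) (seq y m)) (h₁ m (ℕ.m⊔n≤o⇒m≤o M N m≥))))
      (ℚ.+-monoˡ-< (½ ℚ.* ε) (h₂ m (ℕ.m⊔n≤o⇒n≤o M N m≥))))

-- `rationalRoot m` rounds down by less than 1/(m + 1).
square-≤⇒<rationalRoot : ∀ m G c h → G ℚ.* G ℚ.≤ c → + 1 ℚ./ suc m ℚ.≤ h →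
  G ℚ.- h ℚ.< rationalRoot m c
square-≤⇒<rationalRoot m G c h G²≤c e≤h = subst (G ℚ.- h ℚ.<_)
  (solve 2 (λ ρ h → ρ :+ h :- h := ρ) refl ρ h)
  (ℚ.+-monoˡ-< (ℚ.- h) (ℚ.<-≤-trans G<ρ+e (ℚ.+-monoʳ-≤ ρ e≤h)))
  where
  ρ = rationalRoot m c
  e = + 1 ℚ./ suc m
  G<ρ+e : G ℚ.< ρ ℚ.+ e
  G<ρ+e = square-cancel-< (0≤p+q (rationalRoot-≥0 m c) (0≤/ 1 m))
    (ℚ.≤-<-trans (ℚ.≤-trans G²≤c (ℚ.p≤p⊔q c 0ℚ)) (rationalRoot-upper m c))

*-cancel-≡ : ∀ r {p q} → 0ℚ ℚ.< r → r ℚ.* p ≡ r ℚ.* q → p ≡ q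
*-cancel-≡ r 0<r eq = ℚ.≤-antisym
  (*-cancel-≤ r 0<r (ℚ.≤-reflexive eq)) (*-cancel-≤ r 0<r (ℚ.≤-reflexive (sym eq)))

bound : ℕ → ℝ
bound n = (fromℕ 3 * fromℕ n - fromℕ 5
           + √ (fromℕ n * fromℕ n + fromℕ 2 * fromℕ n - fromℕ 7)) * fromℚ ½

boundTerm : ℚ → ℕ → ℚ
boundTerm N m = (ι 3 ℚ.* N ℚ.- ι 5 ℚ.+ rationalRoot m (N ℚ.* N ℚ.+ ι 2 ℚ.* N ℚ.- ι 7)) ℚ.* ½

seq-bound : ∀ n m → seq (bound n) m ≡ boundTerm (ι n) m
seq-bound n m = refl

-- K = n − 3, so s = n + 2, rowSum = 2n² + 2n − 8 and numerator = n² + 3n − 5.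
module Gap (K : ℚ) (0≤K : 0ℚ ℚ.≤ K) where

  s N c rowSum numerator : ℚ
  s = ι 5 ℚ.+ K
  N = ι 3 ℚ.+ K
  c = N ℚ.* N ℚ.+ ι 2 ℚ.* N ℚ.- ι 7
  rowSum = ι 2 ℚ.* K ℚ.* K ℚ.+ ι 14 ℚ.* K ℚ.+ ι 16
  numerator = K ℚ.* K ℚ.+ ι 9 ℚ.* K ℚ.+ ι 13

  0<+ : ∀ {p q} → 0ℚ ℚ.≤ p → 0ℚ ℚ.< q → 0ℚ ℚ.< p ℚ.+ q
  0<+ 0≤p 0<q = ℚ.+-mono-≤-< 0≤p 0<q

  0≤K² : 0ℚ ℚ.≤ K ℚ.* K
  0≤K² = 0≤p*q 0≤K 0≤K

  0<s : 0ℚ ℚ.< s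
  0<s = subst (0ℚ ℚ.<_) (ℚ.+-comm K (ι 5)) (0<+ 0≤K (0<ι 4))

  0<rowSum : 0ℚ ℚ.< rowSum
  0<rowSum = 0<+ (0≤p+q (0≤p*q (0≤p*q (0≤ι 2) 0≤K) 0≤K) (0≤p*q (0≤ι 14) 0≤K)) (0<ι 15)

  0<numerator : 0ℚ ℚ.< numerator
  0<numerator = 0<+ (0≤p+q 0≤K² (0≤p*q (0≤ι 9) 0≤K)) (0<ι 12)

  -- s²c − numerator² = 6K² + 46K + 31
  square-≤ : ∀ {G} → s ℚ.* G ≡ numerator → G ℚ.* G ℚ.≤ c
  square-≤ {G} sG = *-cancel-≤ s 0<s (*-cancel-≤ s 0<s (subst (ℚ._≤ s ℚ.* (s ℚ.* c))
    (trans (cong₂ ℚ._*_ (sym sG) (sym sG))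
      (solve 2 (λ s g → (s :* g) :* (s :* g) := s :* (s :* (g :* g))) refl s G))
    (≤-by-slack (ι 6 ℚ.* (K ℚ.* K) ℚ.+ ι 46 ℚ.* K ℚ.+ ι 31)
      (0≤p+q (0≤p+q (0≤p*q (0≤ι 6) 0≤K²) (0≤p*q (0≤ι 46) 0≤K)) (0≤ι 31))
      (solve 1 (λ K →
        let s = con (ι 5) :+ K
            N = con (ι 3) :+ K
            c = N :* N :+ con (ι 2) :* N :- con (ι 7)
            u = K :* K :+ con (ι 9) :* K :+ con (ι 13)
        in s :* (s :* c) :=
           u :* u :+ (con (ι 6) :* (K :* K) :+ con (ι 46) :* K :+ con (ι 31)))
        refl K))))

  -- The origin of `numerator`: it makes s(3N - 5) + numerator = 2 rowSum + 1 an identity. As G is a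
  -- lower bound for √c, the bound exceeds r by at least h/2.
  linear : ∀ {G r h} → s ℚ.* G ≡ numerator → s ℚ.* r ≡ rowSum → s ℚ.* h ≡ 1ℚ →
    ι 3 ℚ.* N ℚ.- ι 5 ℚ.+ G ≡ r ℚ.+ r ℚ.+ h
  linear {G} {r} {h} sG sr sh = *-cancel-≡ s 0<s (begin
    s ℚ.* (ι 3 ℚ.* N ℚ.- ι 5 ℚ.+ G)
      ≡⟨ ℚ.*-distribˡ-+ s (ι 3 ℚ.* N ℚ.- ι 5) G ⟩
    s ℚ.* (ι 3 ℚ.* N ℚ.- ι 5) ℚ.+ s ℚ.* G
      ≡⟨ cong (s ℚ.* (ι 3 ℚ.* N ℚ.- ι 5) ℚ.+_) sG ⟩
    s ℚ.* (ι 3 ℚ.* N ℚ.- ι 5) ℚ.+ numerator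
      ≡⟨ solve 1 (λ K →
           (con (ι 5) :+ K) :* (con (ι 3) :* (con (ι 3) :+ K) :- con (ι 5)) :+
             (K :* K :+ con (ι 9) :* K :+ con (ι 13)) :=
           (con (ι 2) :* K :* K :+ con (ι 14) :* K :+ con (ι 16)) :+
           (con (ι 2) :* K :* K :+ con (ι 14) :* K :+ con (ι 16)) :+ con 1ℚ) refl K ⟩
    rowSum ℚ.+ rowSum ℚ.+ 1ℚ
      ≡⟨ cong₂ (λ a b → a ℚ.+ a ℚ.+ b) (sym sr) (sym sh) ⟩
    s ℚ.* r ℚ.+ s ℚ.* r ℚ.+ s ℚ.* h
      ≡⟨ solve 3 (λ s r h → s :* r :+ s :* r :+ s :* h := s :* (r :+ r :+ h)) refl s r h ⟩
    s ℚ.* (r ℚ.+ r ℚ.+ h) ∎)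
    where open ≡-Reasoning

  -- At late terms the rounded root loses less than h/2 of the surplus h; halving leaves h/4,
  -- written as two parts of h/8.
  boundTerm-lower : ∀ {r G h} → s ℚ.* r ≡ rowSum → s ℚ.* G ≡ numerator → s ℚ.* h ≡ 1ℚ →
    ∀ m → + 1 ℚ./ suc m ℚ.≤ ½ ℚ.* h →
    r ℚ.+ ½ ℚ.* (½ ℚ.* (½ ℚ.* h)) ℚ.+ ½ ℚ.* (½ ℚ.* (½ ℚ.* h)) ℚ.< boundTerm (ι 3 ℚ.+ K) m
  boundTerm-lower {r} {G} {h} sr sG sh m e≤ = subst (ℚ._< boundTerm (ι 3 ℚ.+ K) m)
    (halve (ι 3 ℚ.* N ℚ.- ι 5) G r h (linear sG sr sh))
    (ℚ.*-monoˡ-<-pos ½ (ℚ.+-monoʳ-< (ι 3 ℚ.* N ℚ.- ι 5)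
      (square-≤⇒<rationalRoot m G c (½ ℚ.* h) (square-≤ sG) e≤)))
    where
    halve : ∀ a G r h → a ℚ.+ G ≡ r ℚ.+ r ℚ.+ h → (a ℚ.+ (G ℚ.- ½ ℚ.* h)) ℚ.* ½ ≡
      r ℚ.+ ½ ℚ.* (½ ℚ.* (½ ℚ.* h)) ℚ.+ ½ ℚ.* (½ ℚ.* (½ ℚ.* h))
    halve a G r h eq = trans
      (solve 3 (λ a g h → (a :+ (g :- con ½ :* h)) :* con ½ := (a :+ g :- con ½ :* h) :* con ½)
        refl a G h)
      (trans (cong (λ x → (x ℚ.- ½ ℚ.* h) ℚ.* ½) eq)
        (solve 2 (λ r h → (r :+ r :+ h :- con ½ :* h) :* con ½ :=
           r :+ con ½ :* (con ½ :* (con ½ :* h)) :+ con ½ :* (con ½ :* (con ½ :* h))) refl r h))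

  gap : ∃ λ r → 0ℚ ℚ.< r × (ι 5 ℚ.+ K) ℚ.* r ≡ ι 2 ℚ.* K ℚ.* K ℚ.+ ι 14 ℚ.* K ℚ.+ ι 16 ×
    (∃ λ ε → 0ℚ ℚ.< ε × (∃ λ M → ∀ m → M ≤ℕ m →
    r ℚ.+ ε ℚ.+ ε ℚ.< boundTerm (ι 3 ℚ.+ K) m))
  gap =
    let r , 0<r , sr = divide rowSum s 0<rowSum 0<s
        G , _   , sG = divide numerator s 0<numerator 0<s
        h , 0<h , sh = divide 1ℚ s (ℚ.positive⁻¹ 1ℚ) 0<s
    in r , 0<r , sr , ½ ℚ.* (½ ℚ.* (½ ℚ.* h)) , 0<½p (0<½p (0<½p 0<h)) , ↧ₙ (½ ℚ.* h) , λ m m≥ →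
       boundTerm-lower {r} {G} {h} sr sG sh m (archimedean (½ ℚ.* h) (0<½p 0<h) m m≥)

-- Comparison of the spectral radius with the bound.

ι-rowSum : ∀ k → ι (2 ℕ.* k ℕ.* k ℕ.+ 14 ℕ.* k ℕ.+ 16) ≡
  ι 2 ℚ.* ι k ℚ.* ι k ℚ.+ ι 14 ℚ.* ι k ℚ.+ ι 16
ι-rowSum k = trans (ι-+ (2 ℕ.* k ℕ.* k ℕ.+ 14 ℕ.* k) 16) (cong (ℚ._+ ι 16)
  (trans (ι-+ (2 ℕ.* k ℕ.* k) (14 ℕ.* k)) (cong₂ ℚ._+_
    (trans (ι-* (2 ℕ.* k) k) (cong (ℚ._* ι k) (ι-* 2 k)))
    (ι-* 14 k))))

ι-weighted-row : ∀ {n} a b r (W w : Fin n → ℕ) y → 0ℚ ℚ.< ι a → ι a ℚ.* r ≡ ι b →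
  a ℕ.* Σℕ.sum (λ j → W j ℕ.* w j) ≤ℕ b ℕ.* y →
  Σℚ.sum (λ j → ι (W j) ℚ.* ι (w j)) ℚ.≤ r ℚ.* ι y
ι-weighted-row {n} a b r W w y 0<a ar≡b h = *-cancel-≤ (ι a) 0<a (subst₂ ℚ._≤_
  (trans (ι-* a (Σℕ.sum (λ j → W j ℕ.* w j))) (cong (ι a ℚ.*_)
    (trans (ι-Σ (λ j → W j ℕ.* w j)) (Σℚ.sum-cong-≗ {n} (λ j → ι-* (W j) (w j))))))
  (trans (ι-* b y) (trans (cong (ℚ._* ι y) (sym ar≡b)) (ℚ.*-assoc (ι a) r (ι y))))
  (ι-mono h))

two-missing-bound : ∀ k (D : Digraph (3 ℕ.+ k)) {u v u′ v′} → Missing D u v → Missing D u′ v′ →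
  ¬ (u ≡ u′ × v ≡ v′) → ∀ z → IsEigenvalue (signlessLaplacian D) z →
  ∀ r → 0ℚ ℚ.< r → (ι 5 ℚ.+ ι k) ℚ.* r ≡ ι 2 ℚ.* ι k ℚ.* ι k ℚ.+ ι 14 ℚ.* ι k ℚ.+ ι 16 →
  modulus z ≤ fromℚ r
two-missing-bound k D uv u′v′ distinct z eig r 0<r sr = CollatzWielandt.eigenvalue-bound
  (Q D) (λ i → ι (weight i)) r (ι (5 ℕ.+ k)) 0<r
  (λ i → ι-mono (1≤weight i)) (λ i → ι-mono (weight≤ i))
  (λ i → ι-weighted-row (5 ℕ.+ k) (2 ℕ.* k ℕ.* k ℕ.+ 14 ℕ.* k ℕ.+ 16) r (Q D i) weight (weight i)
    (0<ι (4 ℕ.+ k)) (trans (cong (ℚ._* r) (ι-+ 5 k)) (trans sr (sym (ι-rowSum k))))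
    (weighted-row i))
  z eig
  where open TwoMissing D uv u′v′ distinct

-- One `ε` absorbs the excess of the terms of `q` over r, the other is the gap that `_<_` asks for.
<-bound : ∀ k q r ε → 0ℚ ℚ.< ε →
  (∃ λ M → ∀ m → M ≤ℕ m → seq q m ℚ.< r ℚ.+ ε) →
  (∃ λ M → ∀ m → M ≤ℕ m → r ℚ.+ ε ℚ.+ ε ℚ.< boundTerm (ι 3 ℚ.+ ι k) m) →
  q < bound (suc (suc (suc k)))
<-bound k q r ε 0<ε (M₁ , h₁) (M₂ , h₂) = ε , 0<ε , M₁ ℕ.⊔ M₂ , λ m m≥ →
  ℚ.<-trans (ℚ.+-monoˡ-< ε (h₁ m (ℕ.m⊔n≤o⇒m≤o M₁ M₂ m≥)))
    (subst (r ℚ.+ ε ℚ.+ ε ℚ.<_)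
      (trans (cong (λ N → boundTerm N m) (sym (ι-+ 3 k))) (sym (seq-bound (suc (suc (suc k))) m)))
      (h₂ m (ℕ.m⊔n≤o⇒n≤o M₁ M₂ m≥)))

theorem6p5 : (n : ℕ) → 3 ≤ℕ n →
    (D : Digraph n) → StronglyConnected D →
    ¬ (D ≅ complete n) → ¬ IsCompleteMinusArc D →
    (q : ℝ) → IsSpectralRadius (signlessLaplacian D) q →
    q < (fromℕ 3 * fromℕ n - fromℕ 5
    + √ (fromℕ n * fromℕ n + fromℕ 2 * fromℕ n - fromℕ 7)) * fromℚ ½
theorem6p5 (suc (suc (suc k))) (ℕ.s≤s (ℕ.s≤s (ℕ.s≤s _))) D _ ≇K ≇K-arc q ((z , eig , ∣z∣≈q) , _) =
  let u , v , uv , u′ , v′ , u′v′ , distinct = two-missing D ≇K ≇K-arc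
      r , 0<r , sr , ε , 0<ε , below = Gap.gap (ι k) (0≤ι k)
  in <-bound k q r ε 0<ε
       (≈-≤-eventually {modulus z} {q} {r} ∣z∣≈q
         (two-missing-bound k D uv u′v′ distinct z eig r 0<r sr) ε 0<ε)
       below
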